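{- Let $F$ be a vertex-critical graph with $\chi(F)\geq 3$, and let $h\geq 2$ be an integer. Then, for all sufficiently large $n$, $$\mathrm{ex}(n,hF)=\max_{1\leq \ell\leq h}\left\{\binom{\ell-1}{2}+(\ell-1)(n-\ell+1)+\mathrm{ex}(n-\ell+1,F)\right\}=\binom{h-1}{2}+(h-1)(n-h+1)+\mathrm{ex}(n-h+1,F).$$ Moreover, every graph in $\mathrm{EX}(n,hF)$ is of the form $K_{h-1}\prod H$, where $H\in\mathrm{EX}(n-h+1,F)$.
   Context: All graphs are finite, simple and undirected; $\chi(G)$ is the chromatic number. For a graph $F$, a graph $G$ is $F$-free if it contains no subgraph isomorphic to $F$; $\mathrm{EX}(n,F)$ is the set of $F$-free graphs on $n$ vertices with the maximum possible number of edges, and $\mathrm{ex}(n,F)$ is the number of edges of any graph in $\mathrm{EX}(n,F)$. A graph $F$ is vertex-critical if there is a vertex $u$ of $F$ with $\chi(F-u)=\chi(F)-1$. $hF$ denotes the vertex-disjoint union of $h$ copies of $F$. For graphs $G_1,G_2$, $G_1\prod G_2$ denotes the join: the disjoint union of $G_1$ and $G_2$ together with all edges between $V(G_1)$ and $V(G_2)$. $K_m$ is the complete graph on $m$ vertices, and $\binom{a}{2}=0$ for $a\in\{0,1\}$. -}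

module Defs where

open import Data.Nat using (ℕ; zero; suc; _+_; _*_; _∸_; _≤_; _⊔_; _<ᵇ_)
open import Data.Nat.Combinatorics using (_C_)
open import Data.Bool using (Bool; true; false; _∧_; not; if_then_else_)
open import Data.Bool.Properties using (∧-zeroʳ)
open import Data.Fin using (Fin; toℕ; _≟_; punchIn)
open import Data.List using (List; map; allFin)
open import Data.Nat.ListAction using (sum)
open import Data.Product using (Σ; _×_; _,_)
open import Data.Sum using (_⊎_; inj₁; inj₂)
open import Relation.Nullary using (¬_; yes; no)
open import Relation.Nullary.Decidable using (⌊_⌋)
open import Relation.Binary.PropositionalEquality using (_≡_; _≢_; refl; sym)
open import Function.Definitions using (Injective)
open import Function.Bundles using (_↔_; Inverse)

record Graph (V : Set) : Set where
  field
    adj    : V → V → Bool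
    adjSym : ∀ x y → adj x y ≡ adj y x
    adjIrr : ∀ x → adj x x ≡ false
open Graph public

eqᶠ : ∀ {k} → Fin k → Fin k → Bool
eqᶠ a b = ⌊ a ≟ b ⌋

eqᶠ-sym : ∀ {k} (a b : Fin k) → eqᶠ a b ≡ eqᶠ b a
eqᶠ-sym a b with a ≟ b | b ≟ a
... | yes _ | yes _ = refl
... | no _  | no _  = refl
... | yes p | no q  = Data.Empty.⊥-elim (q (sym p)) where import Data.Empty
... | no q  | yes p = Data.Empty.⊥-elim (q (sym p)) where import Data.Empty

eqᶠ-refl : ∀ {k} (a : Fin k) → eqᶠ a a ≡ true
eqᶠ-refl a with a ≟ a
... | yes _ = refl
... | no q  = Data.Empty.⊥-elim (q refl) where import Data.Empty

edgeCount : ∀ {n} → Graph (Fin n) → ℕ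
edgeCount {n} G =
  sum (map (λ i → sum (map (λ j →
         if (toℕ i <ᵇ toℕ j) ∧ adj G i j then 1 else 0) (allFin n))) (allFin n))

Contains : ∀ {V W : Set} → Graph V → Graph W → Set
Contains {V} {W} F G =
  Σ (V → W) λ f → Injective _≡_ _≡_ f ×
    (∀ x y → adj F x y ≡ true → adj G (f x) (f y) ≡ true)

Free : ∀ {V W : Set} → Graph V → Graph W → Set
Free F G = ¬ Contains F G

InEX : ∀ {V : Set} (n : ℕ) → Graph V → Graph (Fin n) → Set
InEX n F G = Free F G × (∀ (G′ : Graph (Fin n)) → Free F G′ → edgeCount G′ ≤ edgeCount G)

IsEx : ∀ {V : Set} (n : ℕ) → Graph V → ℕ → Set
IsEx n F e = Σ (Graph (Fin n)) (λ G → InEX n F G × edgeCount G ≡ e)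

Colorable : ∀ {V : Set} → Graph V → ℕ → Set
Colorable {V} G k =
  Σ (V → Fin k) λ c → ∀ x y → adj G x y ≡ true → c x ≢ c y

HasChromaticNumber : ∀ {V : Set} → Graph V → ℕ → Set
HasChromaticNumber G k = Colorable G k × (∀ j → Colorable G j → k ≤ j)

deleteVertex : ∀ {m} → Graph (Fin (suc m)) → Fin (suc m) → Graph (Fin m)
deleteVertex F u = record
  { adj    = λ i j → adj F (punchIn u i) (punchIn u j)
  ; adjSym = λ i j → adjSym F (punchIn u i) (punchIn u j)
  ; adjIrr = λ i → adjIrr F (punchIn u i)
  }

VertexCritical : ∀ {m} → Graph (Fin (suc m)) → Set
VertexCritical F =
  Σ (Fin _) λ u → Σ ℕ λ k →
    HasChromaticNumber F k × HasChromaticNumber (deleteVertex F u) (k ∸ 1)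

copies : ∀ {V : Set} (h : ℕ) → Graph V → Graph (Fin h × V)
copies h F = record
  { adj    = λ { (a , x) (b , y) → eqᶠ a b ∧ adj F x y }
  ; adjSym = λ { (a , x) (b , y) → symLem a b x y }
  ; adjIrr = λ { (a , x) → irrLem a x }
  }
  where
  symLem : ∀ a b x y → (eqᶠ a b ∧ adj F x y) ≡ (eqᶠ b a ∧ adj F y x)
  symLem a b x y rewrite eqᶠ-sym a b | adjSym F x y = refl
  irrLem : ∀ a x → (eqᶠ a a ∧ adj F x x) ≡ false
  irrLem a x rewrite adjIrr F x = ∧-zeroʳ (eqᶠ a a)

complete : (k : ℕ) → Graph (Fin k)
complete k = record
  { adj    = λ a b → not (eqᶠ a b)
  ; adjSym = λ a b → symLem a b
  ; adjIrr = λ a → irrLem a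
  }
  where
  symLem : ∀ a b → not (eqᶠ a b) ≡ not (eqᶠ b a)
  symLem a b rewrite eqᶠ-sym a b = refl
  irrLem : ∀ a → not (eqᶠ a a) ≡ false
  irrLem a rewrite eqᶠ-refl a = refl

join : ∀ {V W : Set} → Graph V → Graph W → Graph (V ⊎ W)
join {V} {W} G₁ G₂ = record { adj = a ; adjSym = s ; adjIrr = i }
  where
  a : V ⊎ W → V ⊎ W → Bool
  a (inj₁ x) (inj₁ y) = adj G₁ x y
  a (inj₂ x) (inj₂ y) = adj G₂ x y
  a (inj₁ _) (inj₂ _) = true
  a (inj₂ _) (inj₁ _) = true
  s : ∀ x y → a x y ≡ a y x
  s (inj₁ x) (inj₁ y) = adjSym G₁ x y
  s (inj₂ x) (inj₂ y) = adjSym G₂ x y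
  s (inj₁ _) (inj₂ _) = refl
  s (inj₂ _) (inj₁ _) = refl
  i : ∀ x → a x x ≡ false
  i (inj₁ x) = adjIrr G₁ x
  i (inj₂ x) = adjIrr G₂ x

Isomorphic : ∀ {V W : Set} → Graph V → Graph W → Set
Isomorphic {V} {W} G H =
  Σ (V ↔ W) λ e → ∀ x y → adj G x y ≡ adj H (Inverse.to e x) (Inverse.to e y)

maxFrom1 : ℕ → (ℕ → ℕ) → ℕ
maxFrom1 zero          g = 0
maxFrom1 (suc zero)    g = g 1
maxFrom1 (suc (suc k)) g = maxFrom1 (suc k) g ⊔ g (suc (suc k))

term : (exF : ℕ → ℕ) (n ℓ : ℕ) → ℕ
term exF n ℓ = ((ℓ ∸ 1) C 2) + (ℓ ∸ 1) * ((n + 1) ∸ ℓ) + exF ((n + 1) ∸ ℓ)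

{-# OPTIONS --safe #-}
-- Write χ(F) = r + 1. A vertex v of very large degree in an (almost) extremal graph G has a neighbourhood
-- dense enough to contain, by Erdős–Stone, a large complete r-partite graph, and as F - u is r-colourable
-- this yields copies of F through v avoiding any bounded set of vertices. Hence an hF-free G has at most
-- h - 1 such vertices, and together with a packing of copies of F among the remaining vertices still fewer
-- than h copies. If the packing were non-empty, or there were fewer than h - 1 big vertices, then deleting
-- the vertices of the packing (resp. one small vertex) and putting back one universal vertex per copy, the
-- others as clones of |F| + 1 vertices with a common neighbourhood of size about (1 - 1/r) n, would keep the
-- graph hF-free and increase the number of edges. Such vertices exist because in a graph without F any
-- vertex misses almost all of some part of a complete r-partite graph. So the extremal graphs consist of
-- h - 1 universal vertices and an F-free graph.
module Submission where

open import Defs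
open import Algebra.Properties.CommutativeMonoid.Sum using ()
open import Data.Bool using (Bool; true; false; _∧_; _∨_; not; if_then_else_) renaming (T to IsTrue)
import Data.Bool.Properties as Bool
open import Data.Empty using (⊥; ⊥-elim)
open import Data.Fin using (Fin; zero; suc; toℕ; fromℕ<; combine; inject≤; punchOut; remQuot; splitAt; _≟_; _↑ˡ_; _↑ʳ_) renaming (join to joinᶠ)
open import Data.Fin.Properties using (all?; any?; combine-injective; combine-injectiveʳ; fromℕ<-injective; inject≤-injective; injective⇒≤; join-splitAt; punchIn-punchOut; remQuot-combine; splitAt-join; splitAt-↑ʳ; splitAt-↑ˡ; toℕ-injective; toℕ<n; ¬∀⟶∃¬) renaming (suc-injective to suc-injectiveᶠ)
open import Data.List as List using ()
open import Data.List.Properties using (map-tabulate)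
open import Data.Nat using (ℕ; zero; suc; NonZero; >-nonZero; _+_; _*_; _∸_; _^_; _⊔_; _≤_; _<_; _<ᵇ_; _≤?_; _<?_; s≤s; z≤n)
open import Data.Nat.Combinatorics using (nC1≡n; nCk+nC[k+1]≡[n+1]C[k+1]) renaming (_C_ to _choose_)
open import Data.Nat.DivMod using (_/_; _%_; _mod_; /-monoˡ-≤; m*n/n≡m; m/n*n≤m; m%n<n; m≡m%n+[m/n]*n)
open import Data.Nat.ListAction using () renaming (sum to sumᴸ)
open import Data.Nat.Properties hiding (_≟_)
open import Data.Nat.Tactic.RingSolver using (solve-∀)
open import Data.Product using (Σ; ∃; _×_; _,_; proj₁; proj₂)
open import Data.Sum as Sum using (_⊎_; inj₁; inj₂)
open import Data.Sum.Properties using (inj₁-injective; inj₂-injective)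
open import Data.Unit using (⊤; tt)
open import Function using (_∘_; id)
open import Function.Bundles using (_↔_; Inverse; mk↔ₛ′)
open import Function.Definitions using (Injective)
open import Relation.Binary using (tri<; tri≈; tri>)
open import Relation.Binary.PropositionalEquality
open import Relation.Nullary using (¬_; Dec; yes; no; does)
open import Relation.Nullary.Decidable using (_×-dec_; ¬?)

-- In the code χ(F) = r + 2, so that R = r + 1 is the number of parts of the complete multipartite
-- graphs used. Making a vertex of degree about (1 - 1/R) n universal gains about n / R edges. But
-- the remaining vertices of a copy of F may have equally large degrees, and deleting them would
-- cost far more than this gain. Clones retain degree (1 - 1/R) n up to an error, so one gain of n /
-- R per copy has to beat only |F| errors. All errors are multiples of a single unit e, and a fixed
-- ratio n / e, the `thresholdFactor`, suffices. The unit enters through a core: all but e vertices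
-- of an extremal graph form a set in which each has at most n / R + e non-neighbours. This takes no
-- stability theorem: the Turán graph bounds the number of non-edges from above, Erdős-Stone applied
-- to subsets bounds it from below, and deleting too many vertices would violate the two bounds.
-- Constructively, an extremal graph cannot simply be taken as given. The structure is therefore
-- shown for an arbitrary one; it fixes the number of edges, which bounds every hF-free graph, and
-- the join attains the bound.

open Algebra.Properties.CommutativeMonoid.Sum +-0-commutativeMonoid using (sum; sum-cong-≗; sum-permute; ∑-comm; ∑-distrib-+)

-- Linear arithmetic: to derive l ≤ r from a ≤ b, exhibit the slack c in l + b + c ≡ r + a.
linear : ∀ {a b l r} → a ≤ b → (c : ℕ) → l + b + c ≡ r + a → l ≤ r
linear {a} {b} {l} {r} a≤b c e = +-cancelʳ-≤ b l r (begin
  l + b     ≤⟨ m≤m+n (l + b) c ⟩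
  l + b + c ≡⟨ e ⟩
  r + a     ≤⟨ +-monoʳ-≤ r a≤b ⟩
  r + b     ∎)
  where open ≤-Reasoning

-- Reasoning with Boolean-valued predicates

true≢false : {b : Bool} → b ≡ true → b ≡ false → ⊥
true≢false refl ()

≢true⇒false : {b : Bool} → ¬ (b ≡ true) → b ≡ false
≢true⇒false {true}  h = ⊥-elim (h refl)
≢true⇒false {false} _ = refl

∧-intro : ∀ {a b} → a ≡ true → b ≡ true → a ∧ b ≡ true
∧-intro refl refl = refl

∧-left : ∀ {a b} → a ∧ b ≡ true → a ≡ true
∧-left {true} _ = refl

∧-right : ∀ {a b} → a ∧ b ≡ true → b ≡ true
∧-right {true} e = e

not-intro : ∀ {a} → a ≡ false → not a ≡ true
not-intro refl = refl

not-elim : ∀ {a} → not a ≡ true → a ≡ false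
not-elim {false} _ = refl

does-true : {P : Set} (d : Dec P) → does d ≡ true → P
does-true (yes p) _ = p

true-does : {P : Set} (d : Dec P) → P → does d ≡ true
true-does (yes _) _ = refl
true-does (no ¬p) p = ⊥-elim (¬p p)

does-false : {P : Set} (d : Dec P) → does d ≡ false → ¬ P
does-false (no ¬p) _ = ¬p

eqᶠ⇒≡ : ∀ {k} (a b : Fin k) → eqᶠ a b ≡ true → a ≡ b
eqᶠ⇒≡ a b e with a ≟ b
... | yes p = p

eqᶠ-≢ : ∀ {k} (a b : Fin k) → a ≢ b → eqᶠ a b ≡ false
eqᶠ-≢ a b ne with a ≟ b
... | yes p = ⊥-elim (ne p)
... | no _  = refl

ind : Bool → ℕ
ind true  = 1
ind false = 0

ind≤1 : ∀ b → ind b ≤ 1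
ind≤1 true  = s≤s z≤n
ind≤1 false = z≤n

ind-mono : ∀ {a b} → (a ≡ true → b ≡ true) → ind a ≤ ind b
ind-mono {false} _ = z≤n
ind-mono {true}  h rewrite h refl = s≤s z≤n

ind-compl : ∀ b → ind b + ind (not b) ≡ 1
ind-compl true  = refl
ind-compl false = refl

ind-split : ∀ a b → ind a ≡ ind (a ∧ b) + ind (a ∧ not b)
ind-split true  true  = refl
ind-split true  false = refl
ind-split false _     = refl

-- Sums and cardinalities over Fin n

sum-mono : ∀ {n} {f g : Fin n → ℕ} → (∀ i → f i ≤ g i) → sum f ≤ sum g
sum-mono {zero}  _ = z≤n
sum-mono {suc n} h = +-mono-≤ (h zero) (sum-mono (h ∘ suc))

sum-mono-< : ∀ {n} {f g : Fin n → ℕ} → (∀ i → f i ≤ g i) → ∀ j → f j < g j → sum f < sum g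
sum-mono-< {suc n} h zero    lt = +-mono-<-≤ lt (sum-mono (h ∘ suc))
sum-mono-< {suc n} h (suc j) lt = +-mono-≤-< (h zero) (sum-mono-< (h ∘ suc) j lt)

sum-const : ∀ n c → sum {n} (λ _ → c) ≡ n * c
sum-const zero    c = refl
sum-const (suc n) c = cong (c +_) (sum-const n c)

sum-*ˡ : ∀ {n} c (f : Fin n → ℕ) → sum (λ i → c * f i) ≡ c * sum f
sum-*ˡ {zero}  c f = sym (*-zeroʳ c)
sum-*ˡ {suc n} c f rewrite sum-*ˡ c (f ∘ suc) = sym (*-distribˡ-+ c (f zero) _)

term≤sum : ∀ {n} (f : Fin n → ℕ) i → f i ≤ sum f
term≤sum f zero    = m≤m+n _ _
term≤sum f (suc i) = ≤-trans (term≤sum (f ∘ suc) i) (m≤n+m _ _)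

average : ∀ {n} (f : Fin (suc n) → ℕ) → ∃ λ i → suc n * f i ≤ sum f
average {n} f with any? (λ i → suc n * f i ≤? sum f)
... | yes p = p
... | no ¬p = ⊥-elim (<-irrefl refl (begin-strict
    suc n * sum f               ≡⟨ sum-const (suc n) (sum f) ⟨
    sum {suc n} (λ _ → sum f)   <⟨ sum-mono-< {suc n} {λ _ → sum f} (λ i → <⇒≤ (large i)) zero (large zero) ⟩
    sum (λ i → suc n * f i)     ≡⟨ sum-*ˡ (suc n) f ⟩
    suc n * sum f               ∎))
  where
  open ≤-Reasoning
  large : ∀ i → sum f < suc n * f i
  large i = ≰⇒> (λ le → ¬p (i , le))

Sub : ℕ → Set
Sub n = Fin n → Bool

_∈_ : ∀ {n} → Fin n → Sub n → Set
x ∈ P = P x ≡ true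

_⊆_ : ∀ {n} → Sub n → Sub n → Set
P ⊆ Q = ∀ x → x ∈ P → x ∈ Q

infix 4 _∈_ _⊆_

# : ∀ {n} → Sub n → ℕ
# P = sum (ind ∘ P)

full : ∀ {n} → Sub n
full _ = true

_∩_ : ∀ {n} → Sub n → Sub n → Sub n
(P ∩ Q) x = P x ∧ Q x

_∖_ : ∀ {n} → Sub n → Sub n → Sub n
(P ∖ Q) x = P x ∧ not (Q x)

infixl 6 _∩_ _∖_

#-mono : ∀ {n} {P Q : Sub n} → P ⊆ Q → # P ≤ # Q
#-mono h = sum-mono (λ x → ind-mono (h x))

#-cong : ∀ {n} {P Q : Sub n} → (∀ x → P x ≡ Q x) → # P ≡ # Q
#-cong h = sum-cong-≗ (λ x → cong ind (h x))

#-full : ∀ n → # (full {n}) ≡ n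
#-full n = trans (sum-const n 1) (*-identityʳ n)

#≤n : ∀ {n} (P : Sub n) → # P ≤ n
#≤n {n} P = subst (# P ≤_) (#-full n) (#-mono {P = P} {full} (λ _ _ → refl))

#-split : ∀ {n} (P Q : Sub n) → # P ≡ # (P ∩ Q) + # (P ∖ Q)
#-split P Q = trans (sum-cong-≗ (λ x → ind-split (P x) (Q x))) (∑-distrib-+ (ind ∘ (P ∩ Q)) (ind ∘ (P ∖ Q)))

#-compl : ∀ {n} (P : Sub n) → # P + # (not ∘ P) ≡ n
#-compl {n} P = trans (sym (#-split full P)) (#-full n)

#-∖ : ∀ {n} (P Q : Sub n) → # P ≤ # (P ∖ Q) + # Q
#-∖ P Q = begin
  # P                   ≡⟨ #-split P Q ⟩
  # (P ∩ Q) + # (P ∖ Q) ≤⟨ +-monoˡ-≤ _ (#-mono {P = P ∩ Q} {Q} (λ _ → ∧-right)) ⟩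
  # Q + # (P ∖ Q)       ≡⟨ +-comm (# Q) _ ⟩
  # (P ∖ Q) + # Q       ∎
  where open ≤-Reasoning

singleton-sum : ∀ {n} (x : Fin n) → # (eqᶠ x) ≡ 1
singleton-sum {suc n} zero    = cong suc (trans (sum-cong-≗ {n} (λ i → refl)) (trans (sum-const n 0) (*-zeroʳ n)))
singleton-sum {suc n} (suc x) = trans (sum-cong-≗ shift) (singleton-sum x)
  where
  shift : ∀ i → ind (eqᶠ (suc x) (suc i)) ≡ ind (eqᶠ x i)
  shift i with x ≟ i
  ... | yes _ = refl
  ... | no _  = refl

remove : ∀ {n} → Sub n → Fin n → Sub n
remove P x = P ∖ eqᶠ x

#-remove : ∀ {n} (P : Sub n) x → x ∈ P → # P ≡ suc (# (remove P x))
#-remove P x x∈P = trans (#-split P (eqᶠ x)) (cong (_+ # (remove P x)) (trans (#-cong single) (singleton-sum x)))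
  where
  single : ∀ y → (P y ∧ eqᶠ x y) ≡ eqᶠ x y
  single y with x ≟ y
  ... | yes refl rewrite x∈P = refl
  ... | no _ with P y
  ...   | true  = refl
  ...   | false = refl

pick : ∀ {n} (P : Sub n) → 1 ≤ # P → ∃ λ x → x ∈ P
pick {suc n} P h with P zero in eq
... | true  = zero , eq
... | false with pick (P ∘ suc) h
...   | x , p = suc x , p

record Listing {n} (t : ℕ) (P : Sub n) : Set where
  field
    at     : Fin t → Fin n
    at-inj : Injective _≡_ _≡_ at
    at-∈   : ∀ i → at i ∈ P

open Listing public

listing : ∀ {n} t (P : Sub n) → t ≤ # P → Listing t P
listing zero    P _ = record { at = λ () ; at-inj = λ { {()} } ; at-∈ = λ () }
listing (suc t) P h with pick P (≤-trans (s≤s z≤n) h)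
... | x , x∈P = record { at = g ; at-inj = g-inj ; at-∈ = g-∈ }
  where
  rest : Listing t (remove P x)
  rest = listing t (remove P x) (≤-pred (subst (suc t ≤_) (#-remove P x x∈P) h))
  g : Fin (suc t) → Fin _
  g zero    = x
  g (suc i) = at rest i
  fresh : ∀ i → x ≢ at rest i
  fresh i e = true≢false (trans (cong (eqᶠ x) (sym e)) (eqᶠ-refl x)) (not-elim (∧-right {P (at rest i)} (at-∈ rest i)))
  g-inj : Injective _≡_ _≡_ g
  g-inj {zero}  {zero}  _ = refl
  g-inj {zero}  {suc j} e = ⊥-elim (fresh j e)
  g-inj {suc i} {zero}  e = ⊥-elim (fresh i (sym e))
  g-inj {suc i} {suc j} e = cong suc (at-inj rest e)
  g-∈ : ∀ i → g i ∈ P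
  g-∈ zero    = x∈P
  g-∈ (suc i) = ∧-left (at-∈ rest i)

#≥injection : ∀ {n k} (P : Sub n) (g : Fin k → Fin n) → Injective _≡_ _≡_ g → (∀ i → g i ∈ P) → k ≤ # P
#≥injection {k = zero}  P g inj g∈ = z≤n
#≥injection {k = suc k} P g inj g∈ = subst (suc k ≤_) (sym (#-remove P (g zero) (g∈ zero)))
  (s≤s (#≥injection (remove P (g zero)) (g ∘ suc) (λ e → suc-injectiveᶠ (inj e))
    (λ i → ∧-intro (g∈ (suc i)) (not-intro (eqᶠ-≢ _ _ (λ e → 0≢suc (inj e)))))))
  where
  0≢suc : ∀ {i : Fin k} → zero ≢ suc i
  0≢suc ()

#≤-injective : ∀ {n k} (P : Sub n) (g : Fin n → Fin k) → (∀ x y → x ∈ P → y ∈ P → g x ≡ g y → x ≡ y) → # P ≤ k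
#≤-injective P g inj = injective⇒≤ {f = g ∘ at l} (λ {i} {j} e → at-inj l (inj _ _ (at-∈ l i) (at-∈ l j) e))
  where l = listing (# P) P ≤-refl

subset-of-size : ∀ {n} k (P : Sub n) → k ≤ # P → Σ (Sub n) λ Q → Q ⊆ P × # Q ≡ k
subset-of-size {n} zero P _ = (λ _ → false) , (λ _ ()) , trans (sum-const n 0) (*-zeroʳ n)
subset-of-size {suc n} (suc k) P h with P zero in eq
... | true with subset-of-size k (P ∘ suc) (≤-pred h)
...   | Q , sub , size = (λ { zero → true ; (suc i) → Q i }) , (λ { zero _ → eq ; (suc i) → sub i }) , cong suc size
subset-of-size {suc n} (suc k) P h | false with subset-of-size (suc k) (P ∘ suc) h
...   | Q , sub , size = (λ { zero → false ; (suc i) → Q i }) , (λ { zero () ; (suc i) → sub i }) , size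

image : ∀ {k n} → (Fin k → Fin n) → Sub n
image g x = does (any? (λ i → g i ≟ x))

image-∈ : ∀ {k n} (g : Fin k → Fin n) i → g i ∈ image g
image-∈ g i = true-does (any? (λ j → g j ≟ g i)) (i , refl)

∈-image : ∀ {k n} (g : Fin k → Fin n) x → x ∈ image g → ∃ λ i → g i ≡ x
∈-image g x h = does-true (any? (λ i → g i ≟ x)) h

#-image : ∀ {k n} (g : Fin k → Fin n) → # (image g) ≤ k
#-image {k} g = injective⇒≤ {f = λ i → proj₁ (preimage i)} inj
  where
  l = listing (# (image g)) (image g) ≤-refl
  preimage : ∀ i → ∃ λ j → g j ≡ at l i
  preimage i = ∈-image g (at l i) (at-∈ l i)
  inj : ∀ {i j} → proj₁ (preimage i) ≡ proj₁ (preimage j) → i ≡ j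
  inj {i} {j} e = at-inj l (trans (sym (proj₂ (preimage i))) (trans (cong g e) (proj₂ (preimage j))))

-- The Erdős–Stone theorem

-- An element x of S counts as a non-neighbour of itself.
nonNbrs : ∀ {n} → Graph (Fin n) → Sub n → Fin n → ℕ
nonNbrs G S x = # (λ y → S y ∧ not (adj G x y))

-- A complete s-partite graph with parts of size t inside S, as a subgraph that need not be induced.
-- Distinct parts are disjoint by `edge`, since adjacency is irreflexive; `inj` speaks of a single
-- part.
record Blowup {n} (G : Graph (Fin n)) (S : Sub n) (s t : ℕ) : Set where
  field
    vert  : Fin s → Fin t → Fin n
    inj   : ∀ i → Injective _≡_ _≡_ (vert i)
    vert∈ : ∀ i a → vert i a ∈ S
    edge  : ∀ i j a b → i ≢ j → adj G (vert i a) (vert j b) ≡ true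

open Blowup public

sum-halves : ∀ {a b c} → 2 * c ≤ a + b → c ≤ a ⊎ c ≤ b
sum-halves {a} {b} {c} h with c ≤? a
... | yes p = inj₁ p
... | no ¬p = inj₂ (+-cancelˡ-≤ c c b (begin
    c + c       ≡⟨ cong (c +_) (+-identityʳ c) ⟨
    2 * c       ≤⟨ h ⟩
    a + b       ≤⟨ +-monoˡ-≤ b (<⇒≤ (≰⇒> ¬p)) ⟩
    c + b       ∎))
  where open ≤-Reasoning

-- Pigeonhole by repeated halving: many elements of X see the vertices g i in the same way.
same-pattern : ∀ {n} (G : Graph (Fin n)) k (g : Fin k → Fin n) (X : Sub n) t → 2 ^ k * t ≤ # X →
  Σ (Sub n) λ Y → Y ⊆ X × t ≤ # Y × (∀ i x y → x ∈ Y → y ∈ Y → adj G (g i) x ≡ adj G (g i) y)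
same-pattern G zero g X t h = X , (λ _ p → p) , subst (_≤ # X) (*-identityˡ t) h , λ ()
same-pattern {n} G (suc k) g X t h = branch (sum-halves (subst₂ _≤_ (*-assoc 2 (2 ^ k) t) (#-split X (adj G (g zero))) h))
  where
  extend : ∀ Z → Z ⊆ X → (∀ x y → x ∈ Z → y ∈ Z → adj G (g zero) x ≡ adj G (g zero) y) → 2 ^ k * t ≤ # Z →
    Σ (Sub n) λ Y → Y ⊆ X × t ≤ # Y × (∀ i x y → x ∈ Y → y ∈ Y → adj G (g i) x ≡ adj G (g i) y)
  extend Z Z⊆X same h′ with same-pattern G k (g ∘ suc) Z t h′
  ... | Y , Y⊆Z , size , agree = Y , (λ x p → Z⊆X x (Y⊆Z x p)) , size ,
    λ { zero x y p q → same x y (Y⊆Z x p) (Y⊆Z y q) ; (suc i) → agree i }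
  branch : _ → _
  branch (inj₁ l) = extend (X ∩ adj G (g zero)) (λ _ → ∧-left)
    (λ x y p q → trans (∧-right {X x} p) (sym (∧-right {X y} q))) l
  branch (inj₂ l) = extend (X ∖ adj G (g zero)) (λ _ → ∧-left)
    (λ x y p q → trans (not-elim (∧-right {X x} p)) (sym (not-elim (∧-right {X y} q)))) l

missing : ∀ {n} {G : Graph (Fin n)} {S s t} → Blowup G S s t → Fin n → ℕ
missing {G = G} K v = sum (λ i → # (λ a → not (adj G (vert K i a) v)))

sum-∧ : ∀ {n} b (P : Sub n) → # (λ a → b ∧ P a) ≡ ind b * # P
sum-∧ {n} false P = trans (sum-const n 0) (*-zeroʳ n)
sum-∧ true P = sym (*-identityˡ (# P))

sum-swap-missing : ∀ {n} {G : Graph (Fin n)} {S s t} (K : Blowup G S s t) →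
  sum (λ v → ind (S v) * missing K v) ≡ sum (λ i → sum (λ a → nonNbrs G S (vert K i a)))
sum-swap-missing {n} {G} {S} {s} {t} K = begin
  sum (λ v → ind (S v) * missing K v)
    ≡⟨ sum-cong-≗ (λ v → sym (trans (sum-cong-≗ (λ i → sum-∧ (S v) (λ a → not (adj G (vert K i a) v)))) (sum-*ˡ (ind (S v)) (λ i → # (λ a → not (adj G (vert K i a) v)))))) ⟩
  sum (λ v → sum (λ i → # (λ a → S v ∧ not (adj G (vert K i a) v))))
    ≡⟨ ∑-comm (λ v i → # (λ a → S v ∧ not (adj G (vert K i a) v))) ⟩
  sum (λ i → sum (λ v → # (λ a → S v ∧ not (adj G (vert K i a) v))))
    ≡⟨ sum-cong-≗ (λ i → ∑-comm (λ v a → ind (S v ∧ not (adj G (vert K i a) v)))) ⟩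
  sum (λ i → sum (λ a → nonNbrs G S (vert K i a))) ∎
  where open ≡-Reasoning

sum-bound : ∀ {n} {f : Fin n → ℕ} {c} → (∀ i → f i ≤ c) → sum f ≤ n * c
sum-bound {n} {c = c} h = subst (_ ≤_) (sum-const n c) (sum-mono h)

-- Double counting of the non-adjacent pairs between K and S: each of the s t vertices of K lies in
-- S and so misses at most μ of S.
missing-total : ∀ {n} {G : Graph (Fin n)} {S s t} μ (K : Blowup G S s t) → (∀ x → x ∈ S → nonNbrs G S x ≤ μ) →
  sum (λ v → ind (S v) * missing K v) ≤ s * (t * μ)
missing-total μ K sparse = subst (_≤ _) (sym (sum-swap-missing K))
  (sum-bound (λ i → sum-bound (λ a → sparse _ (vert∈ K i a))))

module Good {n} {G : Graph (Fin n)} {S s T} (K : Blowup G S s T) (t : ℕ) where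

  nbrs : Fin n → Fin s → ℕ
  nbrs v i = # (λ a → adj G (vert K i a) v)

  good? : ∀ v → Dec (∀ i → t ≤ nbrs v i)
  good? v = all? (λ i → t ≤? nbrs v i)

  good : Sub n
  good v = does (good? v)

  bad-part : ∀ v → ¬ (∀ i → t ≤ nbrs v i) → ∃ λ i → T ≤ # (λ a → not (adj G (vert K i a) v)) + t
  bad-part v ¬good with ¬∀⟶∃¬ s (λ i → t ≤ nbrs v i) (λ i → t ≤? nbrs v i) ¬good
  ... | i , few = i , subst₂ _≤_ (#-compl (λ a → adj G (vert K i a) v)) (+-comm t _)
                       (+-monoˡ-≤ _ (<⇒≤ (≰⇒> few)))

  bad-missing : ∀ v → ¬ (∀ i → t ≤ nbrs v i) → T ≤ missing K v + t
  bad-missing v ¬good with bad-part v ¬good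
  ... | i , h = ≤-trans h (+-monoˡ-≤ t (term≤sum (λ i → # (λ a → not (adj G (vert K i a) v))) i))

-- There are 2 ^ (s T) ways of being joined to the s T vertices of K. By pigeonhole t + 1 good
-- vertices share one of them and become the new part; their common pattern contains t + 1 vertices
-- of each old part.
extend-blowup : ∀ {n} {G : Graph (Fin n)} {S s T} (K : Blowup G S s T) t →
  2 ^ (s * T) * suc t ≤ # (S ∩ Good.good K (suc t)) → Blowup G S (suc s) (suc t)
extend-blowup {n} {G} {S} {s} {T} K t h with same-pattern G (s * T) (λ k → let (i , a) = remQuot T k in vert K i a) (S ∩ Good.good K (suc t)) (suc t) h
... | Y , Y⊆ , size , agree = record { vert = w ; inj = w-inj ; vert∈ = w∈ ; edge = w-edge }
  where
  l = listing (suc t) Y size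
  x₀ = at l zero
  l∈ : ∀ i → at l i ∈ S ∩ Good.good K (suc t)
  l∈ i = Y⊆ _ (at-∈ l i)
  c : ∀ i → Listing (suc t) (λ a → adj G (vert K i a) x₀)
  c i = listing (suc t) _ (does-true (Good.good? K (suc t) x₀) (∧-right {S x₀} (l∈ zero)) i)
  agree′ : ∀ i a y → y ∈ Y → adj G (vert K i a) y ≡ adj G (vert K i a) x₀
  agree′ i a y y∈ = subst (λ k → adj G (vert K (proj₁ k) (proj₂ k)) y ≡ adj G (vert K (proj₁ k) (proj₂ k)) x₀)
    (remQuot-combine {s} i a) (agree (combine i a) y x₀ y∈ (at-∈ l zero))
  w : Fin (suc s) → Fin (suc t) → Fin n
  w zero    a = at l a
  w (suc i) a = vert K i (at (c i) a)
  w-inj : ∀ i → Injective _≡_ _≡_ (w i)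
  w-inj zero    e = at-inj l e
  w-inj (suc i) e = at-inj (c i) (inj K i e)
  w∈ : ∀ i a → w i a ∈ S
  w∈ zero    a = ∧-left (l∈ a)
  w∈ (suc i) a = vert∈ K i _
  cross : ∀ i a b → adj G (w (suc i) a) (w zero b) ≡ true
  cross i a b = trans (agree′ i (at (c i) a) (at l b) (at-∈ l b)) (at-∈ (c i) a)
  w-edge : ∀ i j a b → i ≢ j → adj G (w i a) (w j b) ≡ true
  w-edge zero    zero    a b ne = ⊥-elim (ne refl)
  w-edge zero    (suc j) a b ne = trans (adjSym G _ _) (cross j b a)
  w-edge (suc i) zero    a b ne = cross i a b
  w-edge (suc i) (suc j) a b ne = edge K i j _ _ (λ e → ne (cong suc e))

ind-∖-≤ : ∀ w b g M → (b ≡ true → g ≡ false → w ≤ M) → w * ind (b ∧ not g) ≤ ind b * M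
ind-∖-≤ w false g     M h = ≤-reflexive (*-zeroʳ w)
ind-∖-≤ w true  true  M h = ≤-trans (≤-reflexive (*-zeroʳ w)) z≤n
ind-∖-≤ w true  false M h = subst₂ _≤_ (sym (*-identityʳ w)) (sym (*-identityˡ M)) (h refl refl)

-- The parts have T = (2 + 2q)(t + 1) vertices, and a vertex that is not good misses (1 + 2q)(t + 1)
-- of some part. By `missing-total` and s μ ≤ q |S| / (q + 1), at most 2q |S| / (1 + 2q) vertices
-- are not good. The length T is chosen to leave a positive proportion.
many-good : ∀ {n} {G : Graph (Fin n)} {S s} μ q t →
  (K : Blowup G S s (suc t + (1 + 2 * q) * suc t)) →
  (∀ x → x ∈ S → nonNbrs G S x ≤ μ) → suc q * (s * μ) + # S ≤ suc q * # S →
  # S ≤ (1 + 2 * q) * # (S ∩ Good.good K (suc t))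
many-good {n} {G} {S} {s} μ q t K sparse dense = final
  where
  open Good K (suc t)
  T = suc t + (1 + 2 * q) * suc t
  bad = # (S ∖ good)
  pointwise : ∀ v → ((1 + 2 * q) * suc t) * ind ((S ∖ good) v) ≤ ind (S v) * missing K v
  pointwise v = ind-∖-≤ _ (S v) (good v) _ (λ _ ¬g → +-cancelˡ-≤ (suc t) _ _
    (subst (T ≤_) (+-comm (missing K v) (suc t)) (bad-missing v (does-false (good? v) ¬g))))
  total : suc t * ((1 + 2 * q) * bad) ≤ suc t * ((2 + 2 * q) * (s * μ))
  total = begin
    suc t * ((1 + 2 * q) * bad)
      ≡⟨ solve₁ (suc t) (1 + 2 * q) bad ⟩
    ((1 + 2 * q) * suc t) * bad
      ≡⟨ sum-*ˡ ((1 + 2 * q) * suc t) (ind ∘ (S ∖ good)) ⟨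
    sum (λ v → ((1 + 2 * q) * suc t) * ind ((S ∖ good) v))
      ≤⟨ sum-mono pointwise ⟩
    sum (λ v → ind (S v) * missing K v)
      ≤⟨ missing-total μ K sparse ⟩
    s * (T * μ)
      ≡⟨ solve₂ s (suc t) q μ ⟩
    suc t * ((2 + 2 * q) * (s * μ)) ∎
    where
    open ≤-Reasoning
    solve₁ : ∀ a b c → a * (b * c) ≡ (b * a) * c
    solve₁ = solve-∀
    solve₂ : ∀ s t q μ → s * ((t + (1 + 2 * q) * t) * μ) ≡ t * ((2 + 2 * q) * (s * μ))
    solve₂ = solve-∀
  total′ : (1 + 2 * q) * bad ≤ (2 + 2 * q) * (s * μ)
  total′ = *-cancelˡ-≤ (suc t) total
  final : # S ≤ (1 + 2 * q) * # (S ∩ good)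
  final = linear (+-mono-≤ total′ (*-monoʳ-≤ 2 dense)) 0 (eq (# S) (# (S ∩ good)) bad q (s * μ) (#-split S good))
    where
    ring : ∀ g b q M → (g + b) + ((2 + 2 * q) * M + 2 * (suc q * (g + b))) + 0
                     ≡ (1 + 2 * q) * g + ((1 + 2 * q) * b + 2 * (suc q * M + (g + b)))
    ring = solve-∀
    eq : ∀ S g b q M → S ≡ g + b → S + ((2 + 2 * q) * M + 2 * (suc q * S)) + 0
                     ≡ (1 + 2 * q) * g + ((1 + 2 * q) * b + 2 * (suc q * M + S))
    eq _ g b q M refl = ring g b q M

-- Minimum-degree form; the second hypothesis reads s μ ≤ (1 - 1/(q + 1)) |S|.
erdős-stone : ∀ s t q → Σ ℕ λ L → ∀ {n} (G : Graph (Fin n)) (S : Sub n) μ →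
  (∀ x → x ∈ S → nonNbrs G S x ≤ μ) → suc q * (s * μ) + # S ≤ suc q * # S → L ≤ # S →
  Blowup G S (suc s) (suc t)
erdős-stone zero t q = suc t , λ G S μ sparse dense large →
  let l = listing (suc t) S large in record
  { vert = λ _ → at l ; inj = λ _ → at-inj l ; vert∈ = λ _ → at-∈ l
  ; edge = λ { zero zero _ _ ne → ⊥-elim (ne refl) } }
erdős-stone (suc s) t q with erdős-stone s (t + (1 + 2 * q) * suc t) q
-- The recursive call supplies parts long enough to be thinned out; the second summand guarantees
-- `M` good vertices, as at least one vertex of S in 1 + 2q is good.
... | L , build = L + (1 + 2 * q) * M , λ G S μ sparse dense large →
  let K = build G S μ sparse
            (≤-trans (+-monoˡ-≤ (# S) (*-monoʳ-≤ (suc q) (*-monoˡ-≤ μ (n≤1+n s)))) dense)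
            (≤-trans (m≤m+n L _) large)
  in extend-blowup K t (*-cancelˡ-≤ (1 + 2 * q)
       (≤-trans (≤-trans (m≤n+m _ L) large) (many-good μ q t K sparse dense)))
  where M = 2 ^ (suc s * (suc t + (1 + 2 * q) * suc t)) * suc t

-- Embeddings into vertex subsets

-- Confining copies to a vertex set replaces passing to induced subgraphs, so that every graph keeps
-- the vertex set `Fin n`.
record Embedding {V : Set} (F : Graph V) {n} (G : Graph (Fin n)) (X : Sub n) : Set where
  field
    emb     : V → Fin n
    emb-inj : Injective _≡_ _≡_ emb
    emb-hom : ∀ x y → adj F x y ≡ true → adj G (emb x) (emb y) ≡ true
    emb-∈   : ∀ x → emb x ∈ X

open Embedding public

adj⇒≢ : ∀ {V : Set} (G : Graph V) {x y} → adj G x y ≡ true → x ≢ y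
adj⇒≢ G {x} e refl = true≢false e (adjIrr G x)

-- The colour selects the part and `ix` the position in it: vertices of equal colour differ in
-- position, and those of different colours are separated by an edge.
embed-colourable : ∀ {V : Set} (F : Graph V) {n} {G : Graph (Fin n)} {S s t} → Blowup G S s t →
  Colorable F s → (ix : V → Fin t) → Injective _≡_ _≡_ ix → Embedding F G S
embed-colourable F {G = G} K (c , proper) ix ix-inj = record
  { emb = λ x → vert K (c x) (ix x)
  ; emb-inj = inj′
  ; emb-hom = λ x y e → edge K (c x) (c y) _ _ (proper x y e)
  ; emb-∈ = λ x → vert∈ K _ _ }
  where
  inj′ : Injective _≡_ _≡_ (λ x → vert K (c x) (ix x))
  inj′ {x} {y} e with c x ≟ c y
  ... | yes same = ix-inj (inj K (c y) (subst (λ i → vert K i (ix x) ≡ vert K (c y) (ix y)) same e))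
  ... | no  diff = ⊥-elim (adj⇒≢ G (edge K _ _ _ _ diff) e)

insert : ∀ {n} → Fin n → Sub n → Sub n
insert v X y = eqᶠ v y ∨ X y

insert-self : ∀ {n} (v : Fin n) X → v ∈ insert v X
insert-self v X rewrite eqᶠ-refl v = refl

insert-other : ∀ {n} (v : Fin n) X y → y ∈ X → y ∈ insert v X
insert-other v X y e rewrite e = Bool.∨-zeroʳ _

-- Here vertex-criticality acts: `u` is sent to v and the properly coloured remainder of F into the
-- neighbourhood of v, so the edges at `u` are automatically present.
embed-at-vertex : ∀ {m} (F : Graph (Fin m)) u {n} {G : Graph (Fin n)} {S s} (c : Fin m → Fin s) →
  (∀ x y → x ≢ u → y ≢ u → adj F x y ≡ true → c x ≢ c y) →
  ∀ v → Blowup G (S ∩ adj G v) s m → Embedding F G (insert v (S ∩ adj G v))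
embed-at-vertex {m} F u {n} {G} {S} {s} c proper v K = record
  { emb = λ x → place x (x ≟ u) ; emb-inj = λ {x} {y} → inj′ x y (x ≟ u) (y ≟ u)
  ; emb-hom = λ x y → hom x y (x ≟ u) (y ≟ u) ; emb-∈ = λ x → mem x (x ≟ u) }
  where
  place : ∀ x → Dec (x ≡ u) → Fin n
  place x (yes _) = v
  place x (no _)  = vert K (c x) x
  nbr : ∀ i a → adj G v (vert K i a) ≡ true
  nbr i a = ∧-right {S (vert K i a)} (vert∈ K i a)
  inj′ : ∀ x y dx dy → place x dx ≡ place y dy → x ≡ y
  inj′ x y (yes p) (yes q) e = trans p (sym q)
  inj′ x y (yes p) (no q)  e = ⊥-elim (adj⇒≢ G (nbr _ _) e)
  inj′ x y (no p)  (yes q) e = ⊥-elim (adj⇒≢ G (nbr _ _) (sym e))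
  inj′ x y (no p)  (no q)  e with c x ≟ c y
  ... | yes same = inj K (c y) (subst (λ i → vert K i x ≡ vert K (c y) y) same e)
  ... | no  diff = ⊥-elim (adj⇒≢ G (edge K _ _ _ _ diff) e)
  hom : ∀ x y dx dy → adj F x y ≡ true → adj G (place x dx) (place y dy) ≡ true
  hom x y (yes p) (yes q) e = ⊥-elim (adj⇒≢ F e (trans p (sym q)))
  hom x y (yes p) (no q)  e = nbr _ _
  hom x y (no p)  (yes q) e = trans (adjSym G _ _) (nbr _ _)
  hom x y (no p)  (no q)  e = edge K _ _ _ _ (proper x y p q e)
  mem : ∀ x dx → place x dx ∈ insert v (S ∩ adj G v)
  mem x (yes p) = insert-self v (S ∩ adj G v)
  mem x (no p)  = insert-other v (S ∩ adj G v) _ (vert∈ K _ _)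

restrict-blowup : ∀ {n} {G : Graph (Fin n)} {S s T} (K : Blowup G S s T) t v →
  (∀ i → t ≤ Good.nbrs K t v i) → Blowup G (S ∩ adj G v) s t
restrict-blowup {G = G} {S} K t v h = record
  { vert = λ i a → vert K i (at (c i) a)
  ; inj = λ i e → at-inj (c i) (inj K i e)
  ; vert∈ = λ i a → ∧-intro (vert∈ K i _) (trans (adjSym G v _) (at-∈ (c i) a))
  ; edge = λ i j a b ne → edge K i j _ _ ne }
  where
  c : ∀ i → Listing t (λ a → adj G (vert K i a) v)
  c i = listing t _ (h i)

embedding-mono : ∀ {V : Set} {F : Graph V} {n} {G : Graph (Fin n)} {X Y : Sub n} → X ⊆ Y → Embedding F G X → Embedding F G Y
embedding-mono sub E = record { emb = emb E ; emb-inj = emb-inj E ; emb-hom = emb-hom E ; emb-∈ = λ x → sub _ (emb-∈ E x) }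

embedding⇒contains : ∀ {V : Set} {F : Graph V} {n} {G : Graph (Fin n)} {X : Sub n} → Embedding F G X → Contains F G
embedding⇒contains E = emb E , emb-inj E , emb-hom E

-- Edges and non-edges

-- Ordered adjacent pairs, twice the number of edges. Unlike `edgeCount` this sum is symmetric in
-- the two endpoints, so summations can be interchanged.
arcs : ∀ {n} → Graph (Fin n) → ℕ
arcs G = sum (λ x → # (adj G x))

list-sum : ∀ {n} (f : Fin n → ℕ) → sumᴸ (List.map f (List.allFin n)) ≡ sum f
list-sum {n} f = trans (cong sumᴸ (map-tabulate id f)) (go n f)
  where
  go : ∀ n (f : Fin n → ℕ) → sumᴸ (List.tabulate f) ≡ sum f
  go zero    f = refl
  go (suc n) f = cong (f zero +_) (go n (f ∘ suc))

if-ind : ∀ b → (if b then 1 else 0) ≡ ind b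
if-ind true  = refl
if-ind false = refl

edgeCount-sum : ∀ {n} (G : Graph (Fin n)) → edgeCount G ≡ sum (λ i → # (λ j → (toℕ i <ᵇ toℕ j) ∧ adj G i j))
edgeCount-sum {n} G = trans
  (list-sum (λ i → sumᴸ (List.map (λ j → if (toℕ i <ᵇ toℕ j) ∧ adj G i j then 1 else 0) (List.allFin n))))
  (sum-cong-≗ (λ i → trans (list-sum (λ j → if (toℕ i <ᵇ toℕ j) ∧ adj G i j then 1 else 0))
                           (sum-cong-≗ (λ j → if-ind ((toℕ i <ᵇ toℕ j) ∧ adj G i j)))))

<ᵇ-true : ∀ {m n} → m < n → (m <ᵇ n) ≡ true
<ᵇ-true {m} {n} lt with m <ᵇ n | <⇒<ᵇ lt
... | true | _ = refl

<ᵇ-false : ∀ {m n} → ¬ m < n → (m <ᵇ n) ≡ false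
<ᵇ-false {m} {n} ¬lt = ≢true⇒false (λ e → ¬lt (<ᵇ⇒< m n (subst IsTrue (sym e) _)))

arcs≡2*edges : ∀ {n} (G : Graph (Fin n)) → arcs G ≡ edgeCount G + edgeCount G
arcs≡2*edges {n} G = begin
  arcs G
    ≡⟨ sum-cong-≗ (λ i → trans (sum-cong-≗ (λ j → orient i j)) (∑-distrib-+ (λ j → ind ((toℕ i <ᵇ toℕ j) ∧ adj G i j)) (λ j → ind ((toℕ j <ᵇ toℕ i) ∧ adj G j i)))) ⟩
  sum (λ i → # (λ j → (toℕ i <ᵇ toℕ j) ∧ adj G i j) + # (λ j → (toℕ j <ᵇ toℕ i) ∧ adj G j i))
    ≡⟨ ∑-distrib-+ (λ i → # (λ j → (toℕ i <ᵇ toℕ j) ∧ adj G i j)) (λ i → # (λ j → (toℕ j <ᵇ toℕ i) ∧ adj G j i)) ⟩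
  forward + sum (λ i → # (λ j → (toℕ j <ᵇ toℕ i) ∧ adj G j i))
    ≡⟨ cong (forward +_) (∑-comm (λ i j → ind ((toℕ j <ᵇ toℕ i) ∧ adj G j i))) ⟩
  forward + forward
    ≡⟨ cong₂ _+_ (edgeCount-sum G) (edgeCount-sum G) ⟨
  edgeCount G + edgeCount G ∎
  where
  open ≡-Reasoning
  forward = sum (λ i → # (λ j → (toℕ i <ᵇ toℕ j) ∧ adj G i j))
  orient : ∀ i j → ind (adj G i j) ≡ ind ((toℕ i <ᵇ toℕ j) ∧ adj G i j) + ind ((toℕ j <ᵇ toℕ i) ∧ adj G j i)
  orient i j with <-cmp (toℕ i) (toℕ j)
  ... | tri< a _ c rewrite <ᵇ-true a | <ᵇ-false c = sym (+-identityʳ _)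
  ... | tri> a _ c rewrite <ᵇ-false a | <ᵇ-true c | adjSym G i j = refl
  ... | tri≈ a e c with refl ← toℕ-injective e rewrite <ᵇ-false a | adjIrr G i = refl

-- Ordered pairs, including the diagonal.
nonEdges : ∀ {n} → Graph (Fin n) → Sub n → ℕ
nonEdges G S = sum (λ x → ind (S x) * nonNbrs G S x)

arcs+nonEdges : ∀ {n} (G : Graph (Fin n)) → arcs G + nonEdges G full ≡ n * n
arcs+nonEdges {n} G = begin
  arcs G + nonEdges G full                                            ≡⟨ ∑-distrib-+ (λ x → # (adj G x)) (λ x → 1 * nonNbrs G full x) ⟨
  sum (λ x → # (adj G x) + 1 * nonNbrs G full x)                      ≡⟨ sum-cong-≗ (λ x → trans (cong (# (adj G x) +_) (*-identityˡ _)) (#-compl (adj G x))) ⟩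
  sum {n} (λ _ → n)                                                   ≡⟨ sum-const n n ⟩
  n * n                                                               ∎
  where open ≡-Reasoning

sum-delta : ∀ {n} (v : Fin n) (f : Fin n → ℕ) → sum (λ x → ind (eqᶠ v x) * f x) ≡ f v
sum-delta v f = begin
  sum (λ x → ind (eqᶠ v x) * f x) ≡⟨ sum-cong-≗ point ⟩
  sum (λ x → f v * ind (eqᶠ v x)) ≡⟨ sum-*ˡ (f v) (ind ∘ eqᶠ v) ⟩
  f v * # (eqᶠ v)                 ≡⟨ cong (f v *_) (singleton-sum v) ⟩
  f v * 1                         ≡⟨ *-identityʳ (f v) ⟩
  f v                             ∎
  where
  open ≡-Reasoning
  point : ∀ x → ind (eqᶠ v x) * f x ≡ f v * ind (eqᶠ v x)
  point x with v ≟ x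
  ... | yes refl = *-comm 1 (f v)
  ... | no _     = sym (*-zeroʳ (f v))

ind-∧ : ∀ a b → ind (a ∧ b) ≡ ind a * ind b
ind-∧ true  b = sym (*-identityˡ (ind b))
ind-∧ false b = refl

nonNbrs-remove : ∀ {n} (G : Graph (Fin n)) S v → v ∈ S → ∀ x →
  nonNbrs G S x ≡ nonNbrs G (remove S v) x + ind (not (adj G x v))
nonNbrs-remove G S v v∈S x = begin
  nonNbrs G S x
    ≡⟨ sum-cong-≗ point ⟩
  sum (λ y → ind (remove S v y ∧ not (adj G x y)) + ind (eqᶠ v y) * ind (not (adj G x y)))
    ≡⟨ ∑-distrib-+ (λ y → ind (remove S v y ∧ not (adj G x y))) (λ y → ind (eqᶠ v y) * ind (not (adj G x y))) ⟩
  nonNbrs G (remove S v) x + sum (λ y → ind (eqᶠ v y) * ind (not (adj G x y)))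
    ≡⟨ cong (nonNbrs G (remove S v) x +_) (sum-delta v (λ y → ind (not (adj G x y)))) ⟩
  nonNbrs G (remove S v) x + ind (not (adj G x v)) ∎
  where
  open ≡-Reasoning
  point : ∀ y → ind (S y ∧ not (adj G x y)) ≡ ind (remove S v y ∧ not (adj G x y)) + ind (eqᶠ v y) * ind (not (adj G x y))
  point y with v ≟ y
  ... | yes refl rewrite v∈S = sym (*-identityˡ _)
  ... | no _ = sym (trans (+-identityʳ _) (cong (λ b → ind (b ∧ not (adj G x y))) (Bool.∧-identityʳ (S y))))

-- The row and the column of v contain `nonNbrs G S v` pairs each and share the pair (v, v), whence
-- the `suc`.
nonEdges-remove : ∀ {n} (G : Graph (Fin n)) S v → v ∈ S →
  nonEdges G (remove S v) + 2 * nonNbrs G S v ≡ suc (nonEdges G S)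
nonEdges-remove {n} G S v v∈S = begin
  nonEdges G S′ + 2 * nonNbrs G S v
    ≡⟨ cong (nonEdges G S′ +_) (cong (nonNbrs G S v +_) (+-identityʳ _)) ⟩
  nonEdges G S′ + (nonNbrs G S v + nonNbrs G S v)
    ≡⟨ cong (λ k → nonEdges G S′ + (k + nonNbrs G S v)) (trans (nonNbrs-remove G S v v∈S v) (cong (λ b → nonNbrs G S′ v + ind (not b)) (adjIrr G v))) ⟩
  nonEdges G S′ + (nonNbrs G S′ v + 1 + nonNbrs G S v)
    ≡⟨ shuffle (nonEdges G S′) (nonNbrs G S′ v) (nonNbrs G S v) ⟩
  suc (nonEdges G S′ + nonNbrs G S′ v + nonNbrs G S v)
    ≡⟨ cong suc (cong₂ _+_ old new) ⟨
  suc (sum (λ x → ind (S x) * nonNbrs G S′ x) + sum (λ x → ind (S x) * ind (not (adj G x v))))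
    ≡⟨ cong suc (∑-distrib-+ (λ x → ind (S x) * nonNbrs G S′ x) (λ x → ind (S x) * ind (not (adj G x v)))) ⟨
  suc (sum (λ x → ind (S x) * nonNbrs G S′ x + ind (S x) * ind (not (adj G x v))))
    ≡⟨ cong suc (sum-cong-≗ (λ x → trans (cong (ind (S x) *_) (nonNbrs-remove G S v v∈S x)) (*-distribˡ-+ (ind (S x)) (nonNbrs G S′ x) _))) ⟨
  suc (nonEdges G S) ∎
  where
  open ≡-Reasoning
  S′ = remove S v
  shuffle : ∀ a b c → a + (b + 1 + c) ≡ suc (a + b + c)
  shuffle = solve-∀
  new : sum (λ x → ind (S x) * ind (not (adj G x v))) ≡ nonNbrs G S v
  new = sum-cong-≗ (λ x → trans (cong (λ b → ind (S x) * ind (not b)) (adjSym G x v)) (sym (ind-∧ (S x) _)))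
  point : ∀ x → ind (S x) * nonNbrs G S′ x ≡ ind (S′ x) * nonNbrs G S′ x + ind (eqᶠ v x) * nonNbrs G S′ x
  point x with v ≟ x
  ... | yes refl rewrite v∈S = refl
  ... | no _ = sym (trans (+-identityʳ _) (cong (λ b → ind b * nonNbrs G S′ x) (Bool.∧-identityʳ (S x))))
  old : sum (λ x → ind (S x) * nonNbrs G S′ x) ≡ nonEdges G S′ + nonNbrs G S′ v
  old = trans (sum-cong-≗ point) (trans (∑-distrib-+ (λ x → ind (S′ x) * nonNbrs G S′ x) (λ x → ind (eqᶠ v x) * nonNbrs G S′ x))
          (cong (nonEdges G S′ +_) (sum-delta v (nonNbrs G S′))))

-- Induction step for `nonEdges-lower-bound`: q s² grows by at most 2q (s + 1). The summand s beside
-- N pays for the diagonal pair in N′ + 2d = N + 1.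
nonEdges-step : ∀ q s P C N N′ d → q * (s * s) ≤ P * (N′ + s) + C → q * suc s ≤ P * d → N′ + 2 * d ≡ suc N →
  q * (suc s * suc s) ≤ P * (N + suc s) + C
nonEdges-step q s P C N N′ d h₁ h₂ h₃ =
  linear (+-mono-≤ (+-mono-≤ h₁ (*-monoʳ-≤ 2 h₂)) (*-monoʳ-≤ P (≤-reflexive h₃))) q (ring q s P C N N′ d)
  where
  ring : ∀ q s P C N N′ d →
    q * (suc s * suc s) + (P * (N′ + s) + C + 2 * (P * d) + P * suc N) + q
    ≡ P * (N + suc s) + C + (q * (s * s) + 2 * (q * suc s) + P * (N′ + 2 * d))
  ring = solve-∀

SomeHeavyVertex : ℕ → ℕ → ∀ {n} → Graph (Fin n) → Sub n → Set
SomeHeavyVertex q r G S = ∃ λ v → v ∈ S × q * # S < suc q * suc r * nonNbrs G S v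

heavy-vertex? : ∀ q r {n} (G : Graph (Fin n)) S → Dec (SomeHeavyVertex q r G S)
heavy-vertex? q r G S = any? (λ v → (S v Bool.≟ true) ×-dec (q * # S <? suc q * suc r * nonNbrs G S v))

-- Contrapositive of Erdős-Stone. If no vertex is heavy, then μ = q |S| / ((q + 1)(r + 1)), rounded
-- down, bounds all numbers of non-neighbours, and (r + 1) μ ≤ (1 - 1/(q + 1)) |S| forces r + 2
-- parts.
heavy-vertex : ∀ r t q → Σ ℕ λ L → ∀ {n} (G : Graph (Fin n)) (S : Sub n) →
  ¬ Blowup G S (2 + r) (suc t) → L ≤ # S → SomeHeavyVertex q r G S
heavy-vertex r t q = proj₁ (erdős-stone (suc r) t q) , λ G S free large → find G S free large (heavy-vertex? q r G S)
  where
  d = suc q * suc r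
  find : ∀ {n} (G : Graph (Fin n)) (S : Sub n) → ¬ Blowup G S (2 + r) (suc t) →
    proj₁ (erdős-stone (suc r) t q) ≤ # S → Dec (SomeHeavyVertex q r G S) → SomeHeavyVertex q r G S
  find G S free large (yes heavy) = heavy
  find G S free large (no none) = ⊥-elim (free (proj₂ (erdős-stone (suc r) t q) G S μ small dense large))
    where
    μ = q * # S / d
    small : ∀ x → x ∈ S → nonNbrs G S x ≤ μ
    small x x∈S = subst (_≤ μ) (m*n/n≡m (nonNbrs G S x) d)
      (/-monoˡ-≤ d (subst (_≤ q * # S) (*-comm d (nonNbrs G S x)) (≮⇒≥ (λ lt → none (x , x∈S , lt)))))
    dense : suc q * (suc r * μ) + # S ≤ suc q * # S
    dense = begin
      suc q * (suc r * μ) + # S ≡⟨ cong (_+ # S) (trans (sym (*-assoc (suc q) (suc r) μ)) (*-comm d μ)) ⟩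
      μ * d + # S               ≤⟨ +-monoˡ-≤ (# S) (m/n*n≤m (q * # S) d) ⟩
      q * # S + # S             ≡⟨ +-comm (q * # S) (# S) ⟩
      suc q * # S               ∎
      where open ≤-Reasoning

-- The edge-counting form of Erdős-Stone: heavy vertices are removed one by one, and their
-- non-neighbours add up to about |S|² / (r + 1). The last summand covers the sets with fewer than L
-- vertices, where no heavy vertex is guaranteed.
nonEdges-lower-bound : ∀ r t q → Σ ℕ λ L → ∀ {n} (G : Graph (Fin n)) (S : Sub n) →
  ¬ Blowup G S (2 + r) (suc t) →
  q * (# S * # S) ≤ suc q * suc r * (nonEdges G S + # S) + suc q * (L * L)
nonEdges-lower-bound r t q = proj₁ (heavy-vertex r t q) , λ G S → go _ (proj₂ (heavy-vertex r t q)) (# S) G S refl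
  where
  go : ∀ L → (∀ {n} (G : Graph (Fin n)) (S : Sub n) → ¬ Blowup G S (2 + r) (suc t) → L ≤ # S → SomeHeavyVertex q r G S) →
    ∀ s {n} (G : Graph (Fin n)) (S : Sub n) → # S ≡ s → ¬ Blowup G S (2 + r) (suc t) →
    q * (# S * # S) ≤ suc q * suc r * (nonEdges G S + # S) + suc q * (L * L)
  go L heavy zero    G S size free rewrite size = ≤-trans (≤-reflexive (*-zeroʳ q)) z≤n
  go L heavy (suc s) G S size free with L ≤? # S
  ... | no L≰s = ≤-trans (*-mono-≤ (n≤1+n q) (*-mono-≤ (<⇒≤ (≰⇒> L≰s)) (<⇒≤ (≰⇒> L≰s)))) (m≤n+m (suc q * (L * L)) (suc q * suc r * (nonEdges G S + # S)))
  ... | yes L≤s = step (heavy G S free L≤s)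
    where
    step : SomeHeavyVertex q r G S → q * (# S * # S) ≤ suc q * suc r * (nonEdges G S + # S) + suc q * (L * L)
    step (v , v∈S , many) = subst (λ k → q * (k * k) ≤ suc q * suc r * (nonEdges G S + k) + suc q * (L * L))
      (sym (#-remove S v v∈S))
      (nonEdges-step q (# (remove S v)) (suc q * suc r) (suc q * (L * L)) (nonEdges G S) (nonEdges G (remove S v)) (nonNbrs G S v) ih
        (subst (λ k → q * k ≤ suc q * suc r * nonNbrs G S v) (#-remove S v v∈S) (<⇒≤ many)) (nonEdges-remove G S v v∈S))
      where
      ih : q * (# (remove S v) * # (remove S v)) ≤ suc q * suc r * (nonEdges G (remove S v) + # (remove S v)) + suc q * (L * L)
      ih = go L heavy s G (remove S v) (suc-injective (trans (sym (#-remove S v v∈S)) size))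
             (λ K → free (record { vert = vert K ; inj = inj K ; vert∈ = λ i a → ∧-left (vert∈ K i a) ; edge = edge K }))

-- Deleting vertices with more than μ non-neighbours either stops within z steps or destroys many non-edges.
prune : ∀ {n} (G : Graph (Fin n)) μ z (S : Sub n) →
  (Σ (Sub n) λ S′ → S′ ⊆ S × # S ≤ # S′ + z × (∀ x → x ∈ S′ → nonNbrs G S′ x ≤ μ))
  ⊎ (Σ (Sub n) λ S′ → S′ ⊆ S × # S ≡ # S′ + z × nonEdges G S′ + z * (2 * μ) ≤ nonEdges G S)
prune G μ zero S = inj₂ (S , (λ _ p → p) , sym (+-identityʳ _) , ≤-reflexive (+-identityʳ _))
prune G μ (suc z) S with any? (λ v → (S v Bool.≟ true) ×-dec (μ <? nonNbrs G S v))
... | no none = inj₁ (S , (λ _ p → p) , m≤m+n _ _ , λ x x∈S → ≮⇒≥ (λ lt → none (x , x∈S , lt)))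
... | yes (v , v∈S , many) with prune G μ z (remove S v)
...   | inj₁ (S′ , sub , size , sparse) = inj₁ (S′ , (λ x p → ∧-left (sub x p)) ,
          subst₂ _≤_ (sym (#-remove S v v∈S)) (sym (+-suc (# S′) z)) (s≤s size) , sparse)
...   | inj₂ (S′ , sub , size , few) = inj₂ (S′ , (λ x p → ∧-left (sub x p)) ,
          trans (#-remove S v v∈S) (trans (cong suc size) (sym (+-suc (# S′) z))) ,
          linear (+-mono-≤ (+-mono-≤ few (*-monoʳ-≤ 2 many)) (≤-reflexive (nonEdges-remove G S v v∈S))) 1
            (ring (nonEdges G S) (nonEdges G (remove S v)) (nonEdges G S′) z μ (nonNbrs G S v)))
    where
    ring : ∀ N N₁ N′ z μ d → N′ + suc z * (2 * μ) + (N₁ + 2 * d + suc N) + 1 ≡ N + (N′ + z * (2 * μ) + 2 * suc μ + (N₁ + 2 * d))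
    ring = solve-∀

-- The Turán graph

contains-colorable : ∀ {V W : Set} {F : Graph V} {G : Graph W} {k} → Contains F G → Colorable G k → Colorable F k
contains-colorable (f , _ , hom) (c , proper) = c ∘ f , λ x y e → proper (f x) (f y) (hom x y e)

copies-contain : ∀ {V : Set} (F : Graph V) h → Contains F (copies (suc h) F)
copies-contain F h = (zero ,_) , (λ { refl → refl }) , λ x y e → e

contains-trans : ∀ {U V W : Set} {E : Graph U} {F : Graph V} {G : Graph W} → Contains E F → Contains F G → Contains E G
contains-trans (f , f-inj , f-hom) (g , g-inj , g-hom) =
  g ∘ f , (λ e → f-inj (g-inj e)) , λ x y e → g-hom (f x) (f y) (f-hom x y e)

module _ (r : ℕ) .{{_ : NonZero r}} where

  class : ∀ {n} → Fin n → Fin r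
  class x = toℕ x mod r

  turán : ∀ n → Graph (Fin n)
  turán n = record
    { adj    = λ x y → not (eqᶠ (class x) (class y))
    ; adjSym = λ x y → cong not (eqᶠ-sym (class x) (class y))
    ; adjIrr = λ x → cong not (eqᶠ-refl (class x)) }

  turán-colorable : ∀ n → Colorable (turán n) r
  turán-colorable n = class , λ x y e same → true≢false (trans (cong (eqᶠ (class x)) (sym same)) (eqᶠ-refl (class x))) (not-elim e)

  -- Within a residue class modulo r a number is determined by its quotient, and the quotients lie
  -- in 0, ..., n / r.
  class-size : ∀ {n} (c : Fin r) → # {n} (λ y → eqᶠ c (class y)) ≤ suc (n / r)
  class-size {n} c = #≤-injective (λ y → eqᶠ c (class y)) quotient inj′
    where
    bound : ∀ (y : Fin n) → toℕ y / r < suc (n / r)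
    bound y = s≤s (/-monoˡ-≤ r (<⇒≤ (toℕ<n y)))
    quotient : Fin n → Fin (suc (n / r))
    quotient y = fromℕ< (bound y)
    inj′ : ∀ x y → eqᶠ c (class x) ≡ true → eqᶠ c (class y) ≡ true → quotient x ≡ quotient y → x ≡ y
    inj′ x y p q e = toℕ-injective (begin
      toℕ x                         ≡⟨ m≡m%n+[m/n]*n (toℕ x) r ⟩
      toℕ x % r + toℕ x / r * r     ≡⟨ cong₂ (λ a b → a + b * r) same-class (fromℕ<-injective _ _ (bound x) (bound y) e) ⟩
      toℕ y % r + toℕ y / r * r     ≡⟨ m≡m%n+[m/n]*n (toℕ y) r ⟨
      toℕ y                         ∎)
      where
      open ≡-Reasoning
      same-class : toℕ x % r ≡ toℕ y % r
      same-class = fromℕ<-injective _ _ (m%n<n (toℕ x) r) (m%n<n (toℕ y) r)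
        (trans (sym (eqᶠ⇒≡ c (class x) p)) (eqᶠ⇒≡ c (class y) q))

  turán-nonEdges : ∀ n → nonEdges (turán n) full ≤ n * suc (n / r)
  turán-nonEdges n = sum-bound {f = λ x → 1 * nonNbrs (turán n) full x} (λ x → ≤-trans (≤-reflexive (*-identityˡ _))
    (≤-trans (#-mono {n} {λ y → not (not (eqᶠ (class x) (class y)))} {λ y → eqᶠ (class x) (class y)}
      (λ y e → trans (sym (Bool.not-involutive _)) e)) (class-size (class x))))

edges-mono⇒arcs : ∀ {n} (G G′ : Graph (Fin n)) → edgeCount G ≤ edgeCount G′ → arcs G ≤ arcs G′
edges-mono⇒arcs G G′ h = subst₂ _≤_ (sym (arcs≡2*edges G)) (sym (arcs≡2*edges G′)) (+-mono-≤ h h)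

halve-≤ : ∀ {a b} → a + a ≤ b + b → a ≤ b
halve-≤ {a} {b} h = ≮⇒≥ (λ lt → <⇒≱ (+-mono-< lt lt) h)

arcs-mono⇒edges : ∀ {n} (G G′ : Graph (Fin n)) → arcs G ≤ arcs G′ → edgeCount G ≤ edgeCount G′
arcs-mono⇒edges G G′ h = halve-≤ (subst₂ _≤_ (arcs≡2*edges G) (arcs≡2*edges G′) h)

nonEdges-antitone : ∀ {n} (G G′ : Graph (Fin n)) → edgeCount G ≤ edgeCount G′ → nonEdges G′ full ≤ nonEdges G full
nonEdges-antitone G G′ h = +-cancelˡ-≤ (arcs G) _ _ (begin
  arcs G + nonEdges G′ full  ≤⟨ +-monoˡ-≤ _ (edges-mono⇒arcs G G′ h) ⟩
  arcs G′ + nonEdges G′ full ≡⟨ trans (arcs+nonEdges G′) (sym (arcs+nonEdges G)) ⟩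
  arcs G + nonEdges G full   ∎)
  where open ≤-Reasoning

-- Almost all vertices of a dense graph without a large blowup have few non-neighbours

-- Here r is the number of parts and s the number of vertices left after e deletions. As n² - 2e (n
-- + e) = s² - 3e², the deletions give r N ≤ s² - 3e² + r n, whereas hS says that r N is at least s²
-- up to lower order. The loss from q to q + 1 is at most s² ≤ (q + 1) e², which the 3e² outweighs.
core-arith : ∀ r n k e s N q L → n ≡ s + e → N + e * (2 * (k + e)) ≤ n * suc k →
  q * (s * s) ≤ suc q * r * (N + s) + suc q * (L * L) → r * k ≤ n → n + e ≤ r * (k + e) →
  n * n ≤ suc q * (e * e) → 2 * (r * n) + L * L < 2 * (e * e) → ⊥
core-arith r n k e s N q L refl hN hS rk≤n hμ h₁ h₂ = <-irrefl refl (begin-strict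
    3 * (suc q * (e * e))                                         ≤⟨ step₃ ⟩
    s * s + suc q * (2 * (r * n) + L * L)                         ≤⟨ +-monoˡ-≤ _ (≤-trans (*-mono-≤ (m≤m+n s e) (m≤m+n s e)) h₁) ⟩
    suc q * (e * e) + suc q * (2 * (r * n) + L * L)               <⟨ +-monoʳ-< (suc q * (e * e)) (*-monoʳ-< (suc q) h₂) ⟩
    suc q * (e * e) + suc q * (2 * (e * e))                       ≡⟨ ring₄ (suc q) (e * e) ⟩
    3 * (suc q * (e * e))                                         ∎)
  where
  open ≤-Reasoning
  ring₄ : ∀ a b → a * b + a * (2 * b) ≡ 3 * (a * b)
  ring₄ = solve-∀
  step₁ : r * N + 2 * (e * (n + e)) ≤ n * n + r * n
  step₁ = begin
    r * N + 2 * (e * (n + e))            ≤⟨ +-monoʳ-≤ (r * N) (*-monoʳ-≤ 2 (*-monoʳ-≤ e hμ)) ⟩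
    r * N + 2 * (e * (r * (k + e)))      ≡⟨ ring₁ r N e k ⟩
    r * (N + e * (2 * (k + e)))          ≤⟨ *-monoʳ-≤ r hN ⟩
    r * (n * suc k)                      ≡⟨ ring₂ r n k ⟩
    n * (r * k) + r * n                  ≤⟨ +-monoˡ-≤ (r * n) (*-monoʳ-≤ n rk≤n) ⟩
    n * n + r * n                        ∎
    where
    ring₁ : ∀ r N e k → r * N + 2 * (e * (r * (k + e))) ≡ r * (N + e * (2 * (k + e)))
    ring₁ = solve-∀
    ring₂ : ∀ r n k → r * (n * suc k) ≡ n * (r * k) + r * n
    ring₂ = solve-∀
  step₂ : r * N + 3 * (e * e) ≤ s * s + r * n
  step₂ = linear step₁ 0 (ring (r * N) (r * n) s e)
    where
    ring : ∀ rN rn s e → rN + 3 * (e * e) + ((s + e) * (s + e) + rn) + 0 ≡ s * s + rn + (rN + 2 * (e * (s + e + e)))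
    ring = solve-∀
  step₃ : 3 * (suc q * (e * e)) ≤ s * s + suc q * (2 * (r * n) + L * L)
  step₃ = linear (+-mono-≤ (+-mono-≤ hS (*-monoʳ-≤ (suc q) step₂)) (*-monoʳ-≤ (suc q) (*-monoʳ-≤ r (m≤m+n s e)))) 0
    (ring q r N s (r * n) (e * e) (L * L))
    where
    ring : ∀ q r N s rn E L → 3 * (suc q * E) + (suc q * r * (N + s) + suc q * L + suc q * (s * s + rn) + suc q * rn) + 0
      ≡ s * s + suc q * (2 * rn + L) + (q * (s * s) + suc q * (r * N + 3 * E) + suc q * (r * s))
    ring = solve-∀

Sparse : ∀ {n} → Graph (Fin n) → Sub n → ℕ → Set
Sparse G S μ = ∀ x → x ∈ S → nonNbrs G S x ≤ μ

-- If pruning at k + e did not stop within e steps, the remaining set would have too few non-edges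
-- for a graph without the blowup. The assumed bound on `nonEdges` will come from the Turán graph,
-- with k = n / (r + 1).
sparse-core : ∀ r t q → Σ ℕ λ L → ∀ {n} (G : Graph (Fin n)) k e → ¬ Blowup G full (2 + r) (suc t) →
  nonEdges G full ≤ n * suc k → suc r * k ≤ n → n + e ≤ suc r * (k + e) →
  n * n ≤ suc q * (e * e) → 2 * (suc r * n) + L * L < 2 * (e * e) →
  Σ (Sub n) λ S → n ≤ # S + e × Sparse G S (k + e)
sparse-core r t q with nonEdges-lower-bound r t q
... | L , bound = L , find
  where
  find : ∀ {n} (G : Graph (Fin n)) k e → ¬ Blowup G full (2 + r) (suc t) →
    nonEdges G full ≤ n * suc k → suc r * k ≤ n → n + e ≤ suc r * (k + e) →
    n * n ≤ suc q * (e * e) → 2 * (suc r * n) + L * L < 2 * (e * e) →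
    Σ (Sub n) λ S → n ≤ # S + e × Sparse G S (k + e)
  find {n} G k e free hN hk hμ h₁ h₂ with prune G (k + e) e full
  ... | inj₁ (S , _ , size , sparse) = S , subst (_≤ # S + e) (#-full n) size , sparse
  ... | inj₂ (S , _ , size , few) = ⊥-elim (core-arith (suc r) n k e (# S) (nonEdges G S) q L
      (trans (sym (#-full n)) size) (≤-trans few hN)
      (bound G S (λ K → free (record { vert = vert K ; inj = inj K ; vert∈ = λ _ _ → refl ; edge = edge K })))
      hk hμ h₁ h₂)

-- Universal vertices and clones

univ : ∀ {n} → Graph (Fin n) → Sub n → Graph (Fin n)
univ G U = record
  { adj    = λ x y → not (eqᶠ x y) ∧ (U x ∨ (U y ∨ adj G x y))
  ; adjSym = λ x y → cong₂ _∧_ (cong not (eqᶠ-sym x y)) (swap (U x) (U y) (adjSym G x y))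
  ; adjIrr = λ x → cong (λ b → not b ∧ (U x ∨ (U x ∨ adj G x x))) (eqᶠ-refl x) }
  where
  swap : ∀ a b {c d} → c ≡ d → a ∨ (b ∨ c) ≡ b ∨ (a ∨ d)
  swap true  true  _ = refl
  swap true  false _ = refl
  swap false true  _ = refl
  swap false false e = e

univ-⊇ : ∀ {n} (G : Graph (Fin n)) U x y → adj G x y ≡ true → adj (univ G U) x y ≡ true
univ-⊇ G U x y e rewrite eqᶠ-≢ x y (adj⇒≢ G e) | e | Bool.∨-zeroʳ (U y) = Bool.∨-zeroʳ (U x)

univ-outside : ∀ {n} (G : Graph (Fin n)) U x y → U x ≡ false → U y ≡ false → adj (univ G U) x y ≡ true → adj G x y ≡ true
univ-outside G U x y p q e rewrite p | q = ∧-right {not (eqᶠ x y)} e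

univ-inside : ∀ {n} (G : Graph (Fin n)) U x y → x ∈ U → x ≢ y → adj (univ G U) x y ≡ true
univ-inside G U x y p ne rewrite p | eqᶠ-≢ x y ne = refl

-- Each copy of F meets U, and disjoint copies do so in different vertices.
copies-free : ∀ {m} (F : Graph (Fin m)) h {n} (G : Graph (Fin n)) (U : Sub n) → # U < h →
  ¬ Embedding F G (not ∘ U) → Free (copies h F) G
copies-free {m} F h {n} G U few free (f , f-inj , f-hom) = <⇒≱ few (#≥injection U (λ i → f (i , hit i)) hit-inj hit-∈)
  where
  meets : ∀ i → ∃ λ x → f (i , x) ∈ U
  meets i with any? (λ x → U (f (i , x)) Bool.≟ true)
  ... | yes p = p
  ... | no ¬p = ⊥-elim (free (record
      { emb = λ x → f (i , x) ; emb-inj = λ e → proj₂-inj (f-inj e)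
      ; emb-hom = λ x y e → f-hom (i , x) (i , y) (∧-intro (eqᶠ-refl i) e)
      ; emb-∈ = λ x → not-intro (≢true⇒false (λ p → ¬p (x , p))) }))
    where
    proj₂-inj : ∀ {x y} → (i , x) ≡ (i , y) → x ≡ y
    proj₂-inj refl = refl
  hit : Fin h → Fin m
  hit i = proj₁ (meets i)
  hit-∈ : ∀ i → f (i , hit i) ∈ U
  hit-∈ i = proj₂ (meets i)
  hit-inj : Injective _≡_ _≡_ (λ i → f (i , hit i))
  hit-inj e = cong proj₁ (f-inj e)

univ-free : ∀ {m} (F : Graph (Fin m)) h {n} (G : Graph (Fin n)) (U : Sub n) → # U < h →
  ¬ Embedding F G (not ∘ U) → Free (copies h F) (univ G U)
univ-free F h G U few free = copies-free F h (univ G U) U few (λ E → free (record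
  { emb = emb E ; emb-inj = emb-inj E
  ; emb-hom = λ x y e → univ-outside G U _ _ (not-elim (emb-∈ E x)) (not-elim (emb-∈ E y)) (emb-hom E x y e)
  ; emb-∈ = emb-∈ E }))

-- The arguments tell whether x and y lie in C, whether they lie in Z, and whether they were
-- adjacent. C becomes an independent set whose members all have the part of Z outside C as
-- neighbourhood.
cloneAdj : Bool → Bool → Bool → Bool → Bool → Bool
cloneAdj true  true  _  _  _ = false
cloneAdj true  false _  zy _ = zy
cloneAdj false true  zx _  _ = zx
cloneAdj false false _  _  a = a

clone : ∀ {n} → Graph (Fin n) → Sub n → Sub n → Graph (Fin n)
clone G C Z = record
  { adj    = λ x y → cloneAdj (C x) (C y) (Z x) (Z y) (adj G x y)
  ; adjSym = λ x y → symmetric (C x) (C y) (Z x) (Z y) (adjSym G x y)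
  ; adjIrr = λ x → irreflexive (C x) (Z x) (adjIrr G x) }
  where
  symmetric : ∀ cx cy zx zy {a b} → a ≡ b → cloneAdj cx cy zx zy a ≡ cloneAdj cy cx zy zx b
  symmetric true  true  _ _ _ = refl
  symmetric true  false _ _ _ = refl
  symmetric false true  _ _ _ = refl
  symmetric false false _ _ e = e
  irreflexive : ∀ c z {a} → a ≡ false → cloneAdj c c z z a ≡ false
  irreflexive true  _ _ = refl
  irreflexive false _ e = e

clone-neighbour : ∀ {cx cy zx zy a} → cx ≡ true → cloneAdj cx cy zx zy a ≡ true → cy ≡ false × zy ≡ true
clone-neighbour {true} {false} _ e = refl , e

-- Replace the vertices of a copy lying in C, one at a time, by unused vertices of a set of more than |F|
-- vertices that are adjacent to all of Z.
clone-free : ∀ {m} (F : Graph (Fin m)) {n} (G : Graph (Fin n)) (C Z Y : Sub n) (A : Listing (suc m) (Y ∖ C)) →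
  (∀ i z → z ∈ Z → adj G (at A i) z ≡ true) →
  ¬ Embedding F G (Y ∖ C) → ¬ Embedding F (clone G C Z) Y
clone-free {m} F {n} G C Z Y A common free E₀ = go (# (C ∘ emb E₀)) E₀ refl
  where
  go : ∀ k (E : Embedding F (clone G C Z) Y) → # (C ∘ emb E) ≡ k → ⊥
  go zero E none = free (record
    { emb = emb E ; emb-inj = emb-inj E
    ; emb-hom = λ x y e → subst₂ (λ cx cy → cloneAdj cx cy (Z (emb E x)) (Z (emb E y)) (adj G (emb E x) (emb E y)) ≡ true) (out x) (out y) (emb-hom E x y e)
    ; emb-∈ = λ x → ∧-intro (emb-∈ E x) (not-intro (out x)) })
    where
    out : ∀ x → C (emb E x) ≡ false
    out x = ≢true⇒false (λ p → <⇒≱ (subst (_< 1) (sym none) (s≤s z≤n))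
              (≤-trans (≤-reflexive (sym (cong ind p))) (term≤sum (ind ∘ C ∘ emb E) x)))
  go (suc k) E some with pick (C ∘ emb E) (subst (1 ≤_) (sym some) (s≤s z≤n))
  ... | x₀ , x₀∈C = go k E′ (suc-injective (trans (sym size) some))
    where
    unused : ∃ λ i → ∀ x → emb E x ≢ at A i
    unused with any? (λ i → all? (λ x → ¬? (emb E x ≟ at A i)))
    ... | yes p = p
    ... | no ¬p = ⊥-elim (<-irrefl refl (injective⇒≤ {f = λ i → proj₁ (used i)} used-inj))
      where
      used : ∀ i → ∃ λ x → emb E x ≡ at A i
      used i with any? (λ x → emb E x ≟ at A i)
      ... | yes q = q
      ... | no ¬q = ⊥-elim (¬p (i , λ x e → ¬q (x , e)))
      used-inj : ∀ {i j} → proj₁ (used i) ≡ proj₁ (used j) → i ≡ j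
      used-inj {i} {j} e = at-inj A (trans (sym (proj₂ (used i))) (trans (cong (emb E) e) (proj₂ (used j))))
    a = at A (proj₁ unused)
    a∉C : C a ≡ false
    a∉C = not-elim (∧-right {Y a} (at-∈ A (proj₁ unused)))
    new : ∀ x → Dec (x ≡ x₀) → Fin n
    new x (yes _) = a
    new x (no _)  = emb E x
    new-inj : ∀ x y dx dy → new x dx ≡ new y dy → x ≡ y
    new-inj x y (yes p) (yes q) e = trans p (sym q)
    new-inj x y (yes p) (no q)  e = ⊥-elim (proj₂ unused y (sym e))
    new-inj x y (no p)  (yes q) e = ⊥-elim (proj₂ unused x e)
    new-inj x y (no p)  (no q)  e = emb-inj E e
    -- The old image of `x₀` lies in C, so its neighbours in the copy lie in Z and outside C, and
    -- `a` is adjacent to all of Z.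
    clone-nbr : ∀ y → adj F x₀ y ≡ true → adj (clone G C Z) a (emb E y) ≡ true
    clone-nbr y e = let (y∉C , y∈Z) = clone-neighbour x₀∈C (emb-hom E x₀ y e) in
      subst₂ (λ ca cy → cloneAdj ca cy (Z a) (Z (emb E y)) (adj G a (emb E y)) ≡ true) (sym a∉C) (sym y∉C) (common _ _ y∈Z)
    new-hom : ∀ x y dx dy → adj F x y ≡ true → adj (clone G C Z) (new x dx) (new y dy) ≡ true
    new-hom x y (yes p) (yes q) e = ⊥-elim (adj⇒≢ F e (trans p (sym q)))
    new-hom x y (yes refl) (no q) e = clone-nbr y e
    new-hom x y (no p) (yes refl) e = trans (adjSym (clone G C Z) (emb E x) a) (clone-nbr x (trans (adjSym F y x) e))
    new-hom x y (no p) (no q) e = emb-hom E x y e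
    new-∈ : ∀ x dx → new x dx ∈ Y
    new-∈ x (yes _) = ∧-left (at-∈ A (proj₁ unused))
    new-∈ x (no _)  = emb-∈ E x
    E′ : Embedding F (clone G C Z) Y
    E′ = record { emb = λ x → new x (x ≟ x₀) ; emb-inj = λ {x} {y} → new-inj x y (x ≟ x₀) (y ≟ x₀)
                ; emb-hom = λ x y → new-hom x y (x ≟ x₀) (y ≟ x₀) ; emb-∈ = λ x → new-∈ x (x ≟ x₀) }
    size : # (C ∘ emb E) ≡ suc (# (C ∘ emb E′))
    size = trans (#-remove (C ∘ emb E) x₀ x₀∈C) (cong suc (#-cong same))
      where
      same : ∀ x → remove (C ∘ emb E) x₀ x ≡ C (emb E′ x)
      same x with x ≟ x₀
      ... | yes refl rewrite eqᶠ-refl x | a∉C = Bool.∧-zeroʳ _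
      ... | no ne rewrite eqᶠ-≢ x₀ x (λ e → ne (sym e)) = Bool.∧-identityʳ _

-- Vertices with a large common neighbourhood

sum-++ : ∀ a {b} (f : Fin (a + b) → ℕ) → sum f ≡ sum (λ i → f (i ↑ˡ b)) + sum (λ j → f (a ↑ʳ j))
sum-++ zero    f = refl
sum-++ (suc a) f = trans (cong (f zero +_) (sum-++ a (f ∘ suc))) (sym (+-assoc (f zero) _ _))

sum-combine : ∀ a b (f : Fin (a * b) → ℕ) → sum f ≡ sum (λ i → sum (λ j → f (combine {a} {b} i j)))
sum-combine zero    b f = refl
sum-combine (suc a) b f = trans (sum-++ b f) (cong (sum (λ j → f (j ↑ˡ (a * b))) +_) (sum-combine a b (λ k → f (b ↑ʳ k))))

-- Compare coordinate by coordinate, except that at i₀ the bounds x i₀ ≤ M and T ≤ y i₀ + c take the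
-- place of x i₀ ≤ y i₀.
sum-exchange : ∀ {r} (x y : Fin r → ℕ) i₀ {M T c} → (∀ i → x i ≤ y i) → x i₀ ≤ M → T ≤ y i₀ + c →
  sum x + T ≤ M + c + sum y
sum-exchange x y i₀ {M} {T} {c} x≤y x≤M T≤y = subst₂ _≤_
  (trans (∑-distrib-+ x (λ i → ind (eqᶠ i₀ i) * T)) (cong (sum x +_) (sum-delta i₀ (λ _ → T))))
  (trans (∑-distrib-+ (λ i → ind (eqᶠ i₀ i) * (M + c)) y) (cong (_+ sum y) (sum-delta i₀ (λ _ → M + c))))
  (sum-mono point)
  where
  point : ∀ i → x i + ind (eqᶠ i₀ i) * T ≤ ind (eqᶠ i₀ i) * (M + c) + y i
  point i with i₀ ≟ i
  ... | yes refl = linear (+-mono-≤ x≤M T≤y) 0 (ring (x i₀) (y i₀) M T c)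
    where
    ring : ∀ x y M T c → x + (T + 0) + (M + (y + c)) + 0 ≡ M + c + 0 + y + (x + T)
    ring = solve-∀
  ... | no _ = subst (_≤ y i) (sym (+-identityʳ (x i))) (x≤y i)

sum-ind-const : ∀ {n} (P : Sub n) c → sum (λ v → ind (P v) * c) ≡ # P * c
sum-ind-const P c = trans (sum-cong-≗ (λ v → *-comm (ind (P v)) c)) (trans (sum-*ˡ c (ind ∘ P)) (*-comm c (# P)))

ind-not-does : {P : Set} (d : Dec P) {k : ℕ} → (¬ P → 1 ≤ k) → ind (not (does d)) ≤ k
ind-not-does (yes _) _ = z≤n
ind-not-does (no ¬p) h = h ¬p

-- Each part of K is cut into M + 1 blocks of g vertices, one of which is to have a large common
-- neighbourhood. By `few`, a vertex of S misses almost all of some part. If (r + 1) μ is close to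
-- |S|, a vertex misses only about one part's worth of K on average, so hardly any block of the
-- other parts is affected. Averaging yields a block that only about |S| / (r + 1) vertices fail to
-- dominate.
module CommonNbrs {n} {G : Graph (Fin n)} {S : Sub n} {r M g : ℕ} (K : Blowup G S (suc r) (suc M * g)) (c : ℕ)
  (few : ∀ v → v ∈ S → ¬ (∀ i → c ≤ Good.nbrs K c v i)) (μ : ℕ) (sparse : Sparse G S μ) where

  block : Fin (suc r) → Fin (suc M) → Fin g → Fin n
  block i a b = vert K i (combine a b)

  common? : ∀ i a v → Dec (∀ b → adj G (block i a b) v ≡ true)
  common? i a v = all? (λ b → adj G (block i a b) v Bool.≟ true)

  common : Fin (suc r) → Fin (suc M) → Sub n
  common i a v = does (common? i a v)

  missed : Fin (suc r) → Fin (suc M) → ℕ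
  missed i a = # (S ∖ common i a)

  missed-block : ∀ i a v → ind (not (common i a v)) ≤ # (λ b → not (adj G (block i a b) v))
  missed-block i a v = ind-not-does (common? i a v) λ ¬p →
    let (b , e) = ¬∀⟶∃¬ g (λ b → adj G (block i a b) v ≡ true) (λ b → adj G (block i a b) v Bool.≟ true) ¬p in
    subst (_≤ # (λ b → not (adj G (block i a b) v))) (cong (ind ∘ not) (≢true⇒false e))
      (term≤sum (λ b → ind (not (adj G (block i a b) v))) b)

  missed-part : ∀ i v → # (λ a → not (common i a v)) ≤ # (λ k → not (adj G (vert K i k) v))
  missed-part i v = ≤-trans (sum-mono (λ a → missed-block i a v))
    (≤-reflexive (sym (sum-combine (suc M) g (λ k → ind (not (adj G (vert K i k) v))))))

  -- In the part i₀ all M + 1 blocks may be missed, but then all except at most c of its vertices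
  -- are missed as well. In the other parts every missed block costs at least one missed vertex.
  missed-vertex : ∀ v → v ∈ S → sum (λ i → # (λ a → not (common i a v))) + suc M * g ≤ suc M + c + missing K v
  missed-vertex v v∈S with Good.bad-part K c v (few v v∈S)
  ... | i₀ , bad = sum-exchange (λ i → # (λ a → not (common i a v))) (λ i → # (λ k → not (adj G (vert K i k) v))) i₀
                     (λ i → missed-part i v) (#≤n (λ a → not (common i₀ a v))) bad

  weighted : ∀ v → ind (S v) * sum (λ i → # (λ a → not (common i a v))) + ind (S v) * (suc M * g)
                 ≤ ind (S v) * (suc M + c) + ind (S v) * missing K v
  weighted v = subst₂ _≤_ (*-distribˡ-+ (ind (S v)) (sum (λ i → # (λ a → not (common i a v)))) (suc M * g))
                          (*-distribˡ-+ (ind (S v)) (suc M + c) (missing K v)) (scaled (S v) (missed-vertex v))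
    where
    scaled : ∀ b {x y} → (b ≡ true → x ≤ y) → ind b * x ≤ ind b * y
    scaled true  h = *-monoʳ-≤ 1 (h refl)
    scaled false h = z≤n

  missed-swap : sum (λ v → ind (S v) * sum (λ i → # (λ a → not (common i a v)))) ≡ sum (λ i → sum (λ a → missed i a))
  missed-swap = begin
    sum (λ v → ind (S v) * sum (λ i → # (λ a → not (common i a v))))
      ≡⟨ sum-cong-≗ (λ v → sym (trans (sum-cong-≗ (λ i → sum-∧ (S v) (λ a → not (common i a v)))) (sum-*ˡ (ind (S v)) (λ i → # (λ a → not (common i a v)))))) ⟩
    sum (λ v → sum (λ i → # (λ a → S v ∧ not (common i a v))))
      ≡⟨ ∑-comm (λ v i → # (λ a → S v ∧ not (common i a v))) ⟩
    sum (λ i → sum (λ v → # (λ a → S v ∧ not (common i a v))))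
      ≡⟨ sum-cong-≗ (λ i → ∑-comm (λ v a → ind (S v ∧ not (common i a v)))) ⟩
    sum (λ i → sum (λ a → missed i a)) ∎
    where open ≡-Reasoning

  missed-total : sum (λ i → sum (λ a → missed i a)) + # S * (suc M * g) ≤ # S * (suc M + c) + suc r * (suc M * g * μ)
  missed-total = begin
    sum (λ i → sum (λ a → missed i a)) + # S * (suc M * g)
      ≡⟨ cong₂ _+_ missed-swap (sum-ind-const S (suc M * g)) ⟨
    sum p + sum (λ v → ind (S v) * (suc M * g))
      ≡⟨ ∑-distrib-+ p (λ v → ind (S v) * (suc M * g)) ⟨
    sum (λ v → p v + ind (S v) * (suc M * g))
      ≤⟨ sum-mono weighted ⟩
    sum (λ v → ind (S v) * (suc M + c) + ind (S v) * missing K v)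
      ≡⟨ ∑-distrib-+ (λ v → ind (S v) * (suc M + c)) (λ v → ind (S v) * missing K v) ⟩
    sum (λ v → ind (S v) * (suc M + c)) + sum (λ v → ind (S v) * missing K v)
      ≤⟨ +-mono-≤ (≤-reflexive (sum-ind-const S (suc M + c))) (missing-total μ K sparse) ⟩
    # S * (suc M + c) + suc r * (suc M * g * μ) ∎
    where
    open ≤-Reasoning
    p : Fin n → ℕ
    p v = ind (S v) * sum (λ i → # (λ a → not (common i a v)))

  few-missed : ∃ λ i → ∃ λ a → suc r * (suc M * missed i a) ≤ sum (λ i → sum (λ a → missed i a))
  few-missed with average (λ i → sum (λ a → missed i a))
  ... | i , hi with average (λ a → missed i a)
  ...   | a , ha = i , a , ≤-trans (*-monoʳ-≤ (suc r) ha) hi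

  -- Divided by (r + 1)(M + 1), the inequality reads |Z| ≥ |S| - (1 + c / (M + 1)) |S| / (r + 1) - g
  -- (μ - |S| / (r + 1)). Taking many blocks makes c / (M + 1) small.
  common-nbrs : Σ (Listing g S) λ A → Σ (Sub n) λ Z → Z ⊆ S × (∀ i z → z ∈ Z → adj G (at A i) z ≡ true) ×
    suc r * (suc M * # S) + # S * (suc M * g) ≤ # S * (suc M + c) + suc r * (suc M * g * μ) + suc r * (suc M * # Z)
  common-nbrs = let (i , a , h) = few-missed in
    A i a , S ∩ common i a , (λ _ → ∧-left) , (λ b z z∈ → does-true (common? i a z) (∧-right {S z} z∈) b) ,
    arith (suc r) (suc M) (# S) (# (S ∩ common i a)) (missed i a) (# S * (suc M * g)) (# S * (suc M + c) + suc r * (suc M * g * μ))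
      (sum (λ i → sum (λ a → missed i a))) (#-split S (common i a)) h missed-total
    where
    A : ∀ i a → Listing g S
    A i a = record { at = block i a ; at-inj = λ {b} {b′} e → combine-injectiveʳ a b a b′ (inj K i e) ; at-∈ = λ b → vert∈ K i _ }
    arith : ∀ R m s z d W X T → s ≡ z + d → R * (m * d) ≤ T → T + W ≤ X → R * (m * s) + W ≤ X + R * (m * z)
    arith R m s z d W X T refl h₁ h₂ = linear (+-mono-≤ h₁ h₂) 0 (ring R m z d W X T)
      where
      ring : ∀ R m z d W X T → R * (m * (z + d)) + W + (T + X) + 0 ≡ X + R * (m * z) + (R * (m * d) + (T + W))
      ring = solve-∀

-- Comparing arcs after changing the neighbourhoods of the vertices in W

innerArcs : ∀ {n} → Graph (Fin n) → Sub n → ℕ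
innerArcs G W = sum (λ x → # (λ y → not (W x) ∧ (not (W y) ∧ adj G x y)))

sum₂-mono : ∀ {m n} {f g : Fin m → Fin n → ℕ} → (∀ i j → f i j ≤ g i j) → sum (λ i → sum (f i)) ≤ sum (λ i → sum (g i))
sum₂-mono h = sum-mono (λ i → sum-mono (h i))

sum₂-+₃ : ∀ {m n} (f g k : Fin m → Fin n → ℕ) →
  sum (λ i → sum (λ j → f i j + (g i j + k i j))) ≡ sum (λ i → sum (f i)) + (sum (λ i → sum (g i)) + sum (λ i → sum (k i)))
sum₂-+₃ f g k = begin
  sum (λ i → sum (λ j → f i j + (g i j + k i j)))
    ≡⟨ sum-cong-≗ (λ i → trans (∑-distrib-+ (f i) (λ j → g i j + k i j)) (cong (sum (f i) +_) (∑-distrib-+ (g i) (k i)))) ⟩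
  sum (λ i → sum (f i) + (sum (g i) + sum (k i)))
    ≡⟨ ∑-distrib-+ (λ i → sum (f i)) (λ i → sum (g i) + sum (k i)) ⟩
  sum (λ i → sum (f i)) + sum (λ i → sum (g i) + sum (k i))
    ≡⟨ cong (sum (λ i → sum (f i)) +_) (∑-distrib-+ (λ i → sum (g i)) (λ i → sum (k i))) ⟩
  sum (λ i → sum (f i)) + (sum (λ i → sum (g i)) + sum (λ i → sum (k i))) ∎
  where open ≡-Reasoning

-- Arcs inside W are counted twice here and not at all in `arcs-lower`. The discrepancy is at most 2
-- |W|², negligible since W will have bounded size.
arcs-upper : ∀ {n} (G : Graph (Fin n)) W → arcs G ≤ innerArcs G W + 2 * sum (λ x → ind (W x) * # (adj G x))
arcs-upper {n} G W = begin
  arcs G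
    ≤⟨ sum₂-mono (λ x y → point (W x) (W y) (adj G x y)) ⟩
  sum (λ x → sum (λ y → inner x y + (out x y + into x y)))
    ≡⟨ sum₂-+₃ inner out into ⟩
  innerArcs G W + (sum (λ x → sum (out x)) + sum (λ x → sum (into x)))
    ≡⟨ cong (λ k → innerArcs G W + (sum (λ x → sum (out x)) + k)) into≡out ⟩
  innerArcs G W + (sum (λ x → sum (out x)) + sum (λ x → sum (out x)))
    ≡⟨ cong (λ k → innerArcs G W + (k + k)) (sum-cong-≗ (λ x → sum-∧ (W x) (adj G x))) ⟩
  innerArcs G W + (D + D)
    ≡⟨ cong (innerArcs G W +_) (cong (D +_) (sym (+-identityʳ D))) ⟩
  innerArcs G W + 2 * D ∎
  where
  open ≤-Reasoning
  D = sum (λ x → ind (W x) * # (adj G x))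
  inner out into : Fin n → Fin n → ℕ
  inner x y = ind (not (W x) ∧ (not (W y) ∧ adj G x y))
  out x y = ind (W x ∧ adj G x y)
  into x y = ind (W y ∧ adj G x y)
  point : ∀ a b c → ind c ≤ ind (not a ∧ (not b ∧ c)) + (ind (a ∧ c) + ind (b ∧ c))
  point true  b     c = m≤m+n (ind c) _
  point false true  c = ≤-refl
  point false false c = m≤m+n (ind c) 0
  into≡out : sum (λ x → sum (into x)) ≡ sum (λ x → sum (out x))
  into≡out = trans (∑-comm into) (sum-cong-≗ (λ y → sum-cong-≗ (λ x → cong (λ b → ind (W y ∧ b)) (adjSym G x y))))

arcs-lower : ∀ {n} (G : Graph (Fin n)) W → innerArcs G W + 2 * sum (λ x → ind (W x) * # (λ y → not (W y) ∧ adj G x y)) ≤ arcs G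
arcs-lower {n} G W = begin
  innerArcs G W + 2 * D
    ≡⟨ cong (innerArcs G W +_) (cong (D +_) (+-identityʳ D)) ⟩
  innerArcs G W + (D + D)
    ≡⟨ cong (λ k → innerArcs G W + (k + k)) (sum-cong-≗ (λ x → sum-∧ (W x) (λ y → not (W y) ∧ adj G x y))) ⟨
  innerArcs G W + (sum (λ x → sum (out x)) + sum (λ x → sum (out x)))
    ≡⟨ cong (λ k → innerArcs G W + (sum (λ x → sum (out x)) + k)) into≡out ⟨
  innerArcs G W + (sum (λ x → sum (out x)) + sum (λ x → sum (into x)))
    ≡⟨ sum₂-+₃ inner out into ⟨
  sum (λ x → sum (λ y → inner x y + (out x y + into x y)))
    ≤⟨ sum₂-mono (λ x y → point (W x) (W y) (adj G x y)) ⟩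
  arcs G ∎
  where
  open ≤-Reasoning
  D = sum (λ x → ind (W x) * # (λ y → not (W y) ∧ adj G x y))
  inner out into : Fin n → Fin n → ℕ
  inner x y = ind (not (W x) ∧ (not (W y) ∧ adj G x y))
  out x y = ind (W x ∧ (not (W y) ∧ adj G x y))
  into x y = ind (W y ∧ (not (W x) ∧ adj G x y))
  point : ∀ a b c → ind (not a ∧ (not b ∧ c)) + (ind (a ∧ (not b ∧ c)) + ind (b ∧ (not a ∧ c))) ≤ ind c
  point true  true  c = z≤n
  point true  false c = ≤-reflexive (+-identityʳ (ind c))
  point false true  c = ≤-refl
  point false false c = ≤-reflexive (+-identityʳ (ind c))
  into≡out : sum (λ x → sum (into x)) ≡ sum (λ x → sum (out x))
  into≡out = trans (∑-comm into) (sum-cong-≗ (λ y → sum-cong-≗ (λ x → cong (λ b → ind (W y ∧ (not (W x) ∧ b))) (adjSym G x y))))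

_∪_ : ∀ {n} → Sub n → Sub n → Sub n
(P ∪ Q) x = P x ∨ Q x

infixl 6 _∪_

#-∪ : ∀ {n} (P Q : Sub n) → # (P ∪ Q) ≤ # P + # Q
#-∪ P Q = subst (# (P ∪ Q) ≤_) (∑-distrib-+ (ind ∘ P) (ind ∘ Q)) (sum-mono (λ x → point (P x) (Q x)))
  where
  point : ∀ a b → ind (a ∨ b) ≤ ind a + ind b
  point true  b = m≤m+n 1 _
  point false b = ≤-refl

-- Arcs avoiding W = B ∪ X survive, so those meeting W cannot have become more numerous. Before,
-- vertices of B have degree at most n and those of X at most D; afterwards B ∪ R reaches everything
-- outside W, and each clone reaches Z.
arcs-replace : ∀ {n} (G : Graph (Fin n)) (B X R Z : Sub n) D → R ⊆ X → (∀ x → x ∈ B → X x ≡ false) →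
  (∀ z → z ∈ Z → (B ∪ X) z ≡ false) → (∀ x → x ∈ X → # (adj G x) ≤ D) →
  arcs (univ (clone G (X ∖ R) Z) (B ∪ R)) ≤ arcs G →
  (# B + # R) * # (not ∘ (B ∪ X)) + # (X ∖ R) * # Z ≤ # B * n + # X * D
arcs-replace {n} G B X R Z D R⊆X disjoint Z-out small le = halve-≤ (subst₂ _≤_ (2* new) (2* old) doubled)
  where
  W = B ∪ X
  G′ = univ (clone G (X ∖ R) Z) (B ∪ R)
  new = (# B + # R) * # (not ∘ W) + # (X ∖ R) * # Z
  old = # B * n + # X * D
  2* : ∀ k → 2 * k ≡ k + k
  2* k = cong (k +_) (+-identityʳ k)
  old-bound : sum (λ x → ind (W x) * # (adj G x)) ≤ old
  old-bound = ≤-trans (sum-mono (λ x → point (B x) (X x) (# (adj G x)) (#≤n (adj G x)) (small x)))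
    (≤-reflexive (trans (∑-distrib-+ (λ x → ind (B x) * n) (λ x → ind (X x) * D)) (cong₂ _+_ (sum-ind-const B n) (sum-ind-const X D))))
    where
    point : ∀ b c d → d ≤ n → (c ≡ true → d ≤ D) → ind (b ∨ c) * d ≤ ind b * n + ind c * D
    point true  c     d d≤n d≤D = ≤-trans (*-monoʳ-≤ 1 d≤n) (m≤m+n (1 * n) (ind c * D))
    point false true  d d≤n d≤D = *-monoʳ-≤ 1 (d≤D refl)
    point false false d d≤n d≤D = z≤n
  universal-nbrs : ∀ x → (B ∪ R) x ≡ true → W x ≡ true → # (not ∘ W) ≤ # (λ y → not (W y) ∧ adj G′ x y)
  universal-nbrs x x∈U x∈W = #-mono {P = not ∘ W} {λ y → not (W y) ∧ adj G′ x y}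
    (λ y y∉W → ∧-intro y∉W (univ-inside (clone G (X ∖ R) Z) (B ∪ R) x y x∈U (λ { refl → true≢false x∈W (not-elim y∉W) })))
  clone-nbrs : ∀ x → (X ∖ R) x ≡ true → # Z ≤ # (λ y → not (W y) ∧ adj G′ x y)
  clone-nbrs x x∈C = #-mono {P = Z} {λ y → not (W y) ∧ adj G′ x y}
    (λ y y∈Z → ∧-intro (not-intro (Z-out y y∈Z)) (univ-⊇ (clone G (X ∖ R) Z) (B ∪ R) x y (adjacent y y∈Z)))
    where
    y∉C : ∀ y → y ∈ Z → (X ∖ R) y ≡ false
    y∉C y y∈Z = ≢true⇒false (λ e → true≢false (trans (cong (B y ∨_) (∧-left e)) (Bool.∨-zeroʳ (B y))) (Z-out y y∈Z))
    adjacent : ∀ y → y ∈ Z → adj (clone G (X ∖ R) Z) x y ≡ true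
    adjacent y y∈Z = subst₂ (λ a b → cloneAdj a b (Z x) (Z y) (adj G x y) ≡ true) (sym x∈C) (sym (y∉C y y∈Z)) y∈Z
  new-bound : new ≤ sum (λ x → ind (W x) * # (λ y → not (W y) ∧ adj G′ x y))
  new-bound = ≤-trans (≤-reflexive split) (sum-mono (λ x → point x (B x) (X x) (R x) refl refl refl))
    where
    u = # (not ∘ W)
    split : new ≡ sum (λ x → ind (B x) * u + (ind (R x) * u + ind ((X ∖ R) x) * # Z))
    split = sym (begin
      sum (λ x → ind (B x) * u + (ind (R x) * u + ind ((X ∖ R) x) * # Z))
        ≡⟨ ∑-distrib-+ (λ x → ind (B x) * u) (λ x → ind (R x) * u + ind ((X ∖ R) x) * # Z) ⟩
      sum (λ x → ind (B x) * u) + sum (λ x → ind (R x) * u + ind ((X ∖ R) x) * # Z)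
        ≡⟨ cong₂ _+_ (sum-ind-const B u) (∑-distrib-+ (λ x → ind (R x) * u) (λ x → ind ((X ∖ R) x) * # Z)) ⟩
      # B * u + (sum (λ x → ind (R x) * u) + sum (λ x → ind ((X ∖ R) x) * # Z))
        ≡⟨ cong (# B * u +_) (cong₂ _+_ (sum-ind-const R u) (sum-ind-const (X ∖ R) (# Z))) ⟩
      # B * u + (# R * u + # (X ∖ R) * # Z)
        ≡⟨ +-assoc (# B * u) (# R * u) _ ⟨
      # B * u + # R * u + # (X ∖ R) * # Z
        ≡⟨ cong (_+ # (X ∖ R) * # Z) (*-distribʳ-+ u (# B) (# R)) ⟨
      new ∎)
      where open ≡-Reasoning
    point : ∀ x b c d → B x ≡ b → X x ≡ c → R x ≡ d →
      ind b * u + (ind d * u + ind (c ∧ not d) * # Z) ≤ ind (b ∨ c) * # (λ y → not (W y) ∧ adj G′ x y)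
    point x true  true  d eb ec ed = ⊥-elim (true≢false ec (disjoint x eb))
    point x true  false true eb ec ed = ⊥-elim (true≢false (R⊆X x ed) ec)
    point x true  false false eb ec ed = ≤-trans (≤-reflexive (trans (+-identityʳ (1 * u)) (*-identityˡ u)))
      (≤-trans (universal-nbrs x (cong (_∨ R x) eb) (cong (_∨ X x) eb)) (≤-reflexive (sym (*-identityˡ _))))
    point x false true  true eb ec ed = ≤-trans (≤-reflexive (trans (+-identityʳ (1 * u)) (*-identityˡ u)))
      (≤-trans (universal-nbrs x (trans (cong (B x ∨_) ed) (Bool.∨-zeroʳ (B x))) (trans (cong (B x ∨_) ec) (Bool.∨-zeroʳ (B x)))) (≤-reflexive (sym (*-identityˡ _))))
    point x false true  false eb ec ed = *-monoʳ-≤ 1 (clone-nbrs x (∧-intro ec (not-intro ed)))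
    point x false false true eb ec ed = ⊥-elim (true≢false (R⊆X x ed) ec)
    point x false false false eb ec ed = z≤n
  inner-le : innerArcs G W ≤ innerArcs G′ W
  inner-le = sum₂-mono (λ x y → ind-mono (λ e → ∧-intro (∧-left {not (W x)} e) (∧-intro (∧-left {not (W y)} (∧-right {not (W x)} e)) (keep x y e))))
    where
    keep : ∀ x y → not (W x) ∧ (not (W y) ∧ adj G x y) ≡ true → adj G′ x y ≡ true
    keep x y e = univ-⊇ (clone G (X ∖ R) Z) (B ∪ R) x y
      (subst₂ (λ a b → cloneAdj a b (Z x) (Z y) (adj G x y) ≡ true) (sym (out x (∧-left {not (W x)} e))) (sym (out y (∧-left {not (W y)} (∧-right {not (W x)} e))))
        (∧-right {not (W y)} (∧-right {not (W x)} e)))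
      where
      out : ∀ z → not (W z) ≡ true → (X ∖ R) z ≡ false
      out z z∉W = ≢true⇒false (λ h → true≢false (trans (cong (B z ∨_) (∧-left h)) (Bool.∨-zeroʳ (B z))) (not-elim z∉W))
  doubled : 2 * new ≤ 2 * old
  doubled = +-cancelˡ-≤ (innerArcs G W) _ _ (begin
    innerArcs G W + 2 * new                                                       ≤⟨ +-mono-≤ inner-le (*-monoʳ-≤ 2 new-bound) ⟩
    innerArcs G′ W + 2 * sum (λ x → ind (W x) * # (λ y → not (W y) ∧ adj G′ x y)) ≤⟨ arcs-lower G′ W ⟩
    arcs G′                                                                       ≤⟨ le ⟩
    arcs G                                                                        ≤⟨ arcs-upper G W ⟩
    innerArcs G W + 2 * sum (λ x → ind (W x) * # (adj G x))                       ≤⟨ +-monoʳ-≤ (innerArcs G W) (*-monoʳ-≤ 2 old-bound) ⟩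
    innerArcs G W + 2 * old                                                       ∎)
    where open ≤-Reasoning

-- Packings of disjoint copies

module Packings {m} (F : Graph (Fin (suc m))) {n} (G : Graph (Fin n)) where

  Packing : ℕ → Sub n → Set
  Packing zero    A = ⊤
  Packing (suc k) A = Σ (Embedding F G A) λ E → Packing k (A ∖ image (emb E))

  rest : ∀ k {A} → Packing k A → Sub n
  rest zero    {A} _ = A
  rest (suc k) (E , P) = rest k P

  append : ∀ k l {A} (P : Packing k A) → Packing l (rest k P) → Packing (k + l) A
  append zero    l P       Q = Q
  append (suc k) l (E , P) Q = E , append k l P Q

  ∖-monoˡ : ∀ {A A′ : Sub n} (I : Sub n) → A ⊆ A′ → (A ∖ I) ⊆ (A′ ∖ I)
  ∖-monoˡ I sub x e = ∧-intro (sub x (∧-left e)) (∧-right e)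

  packing-mono : ∀ k {A A′} → A ⊆ A′ → Packing k A → Packing k A′
  packing-mono zero    sub P       = tt
  packing-mono (suc k) sub (E , P) = embedding-mono sub E , packing-mono k (∖-monoˡ (image (emb E)) sub) P

  -- All copies lie in A, so they cannot consume vertices of A′ outside A. This keeps the big
  -- vertices free after packing among the others.
  rest-mono : ∀ k {A A′} (sub : A ⊆ A′) (P : Packing k A) x → x ∈ A′ → A x ≡ false → x ∈ rest k (packing-mono k sub P)
  rest-mono zero    sub P       x x∈ x∉ = x∈
  rest-mono (suc k) {A} sub (E , P) x x∈ x∉ = rest-mono k (∖-monoˡ (image (emb E)) sub) P x
    (∧-intro x∈ (not-intro (≢true⇒false λ hit → let (i , e) = ∈-image (emb E) x hit in
      true≢false (subst (_∈ A) e (emb-∈ E i)) x∉)))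
    (cong (_∧ not (image (emb E) x)) x∉)

  rest-⊆ : ∀ k {A} (P : Packing k A) → rest k P ⊆ A
  rest-⊆ zero    P       x p = p
  rest-⊆ (suc k) (E , P) x p = ∧-left (rest-⊆ k P x p)

  rest-large : ∀ k {A} (P : Packing k A) → # A ≤ # (rest k P) + k * suc m
  rest-large zero    P = m≤m+n _ 0
  rest-large (suc k) {A} (E , P) = begin
    # A                                                  ≤⟨ #-∖ A (image (emb E)) ⟩
    # (A ∖ image (emb E)) + # (image (emb E))            ≤⟨ +-mono-≤ (rest-large k P) (#-image (emb E)) ⟩
    # (rest k P) + k * suc m + suc m                     ≡⟨ ring (# (rest k P)) k (suc m) ⟩
    # (rest k P) + suc k * suc m                         ∎
    where
    open ≤-Reasoning
    ring : ∀ a k f → a + k * f + f ≡ a + suc k * f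
    ring = solve-∀

  -- Charging one vertex to each copy is enough for the later choice of one new universal vertex per
  -- copy.
  rest-small : ∀ k {A} (P : Packing k A) → # (rest k P) + k ≤ # A
  rest-small zero    P = ≤-reflexive (+-identityʳ _)
  rest-small (suc k) {A} (E , P) = begin
    # (rest k P) + suc k                        ≡⟨ +-suc (# (rest k P)) k ⟩
    suc (# (rest k P) + k)                      ≤⟨ s≤s (rest-small k P) ⟩
    suc (# (A ∖ image (emb E)))                 ≤⟨ s≤s (#-mono {P = A ∖ image (emb E)} {remove A x₀} smaller) ⟩
    suc (# (remove A x₀))                       ≡⟨ #-remove A x₀ (emb-∈ E zero) ⟨
    # A                                         ∎
    where
    open ≤-Reasoning
    x₀ = emb E zero
    smaller : (A ∖ image (emb E)) ⊆ remove A x₀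
    smaller x e = ∧-intro (∧-left e) (not-intro (eqᶠ-≢ x₀ x (λ { refl →
      true≢false (image-∈ (emb E) zero) (not-elim (∧-right {A x} e)) })))

  packing⇒embedding : ∀ k {A} → Packing k A → Embedding (copies k F) G A
  packing⇒embedding zero    P = record { emb = λ () ; emb-inj = λ { {() , _} } ; emb-hom = λ () ; emb-∈ = λ () }
  packing⇒embedding (suc k) {A} (E , P) = record { emb = g ; emb-inj = λ {x} {y} → g-inj x y ; emb-hom = g-hom ; emb-∈ = g-∈ }
    where
    E′ = packing⇒embedding k P
    g : Fin (suc k) × Fin (suc m) → Fin n
    g (zero , x)  = emb E x
    g (suc i , x) = emb E′ (i , x)
    apart : ∀ x y → emb E x ≢ emb E′ y
    apart x y e = true≢false (subst (_∈ image (emb E)) e (image-∈ (emb E) x)) (not-elim (∧-right {A (emb E′ y)} (emb-∈ E′ y)))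
    g-inj : ∀ x y → g x ≡ g y → x ≡ y
    g-inj (zero , x)  (zero , y)  e = cong (zero ,_) (emb-inj E e)
    g-inj (zero , x)  (suc j , y) e = ⊥-elim (apart x (j , y) e)
    g-inj (suc i , x) (zero , y)  e = ⊥-elim (apart y (i , x) (sym e))
    g-inj (suc i , x) (suc j , y) e = cong (λ (i , x) → suc i , x) (emb-inj E′ e)
    g-hom : ∀ x y → adj (copies (suc k) F) x y ≡ true → adj G (g x) (g y) ≡ true
    g-hom (zero , x)  (zero , y)  e = emb-hom E x y e
    g-hom (suc i , x) (suc j , y) e = emb-hom E′ (i , x) (j , y)
      (∧-intro (trans (cong (eqᶠ i) (sym (suc-injectiveᶠ (eqᶠ⇒≡ (suc i) (suc j) (∧-left e))))) (eqᶠ-refl i)) (∧-right {eqᶠ (suc i) (suc j)} e))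
    g-∈ : ∀ x → g x ∈ A
    g-∈ (zero , x)  = emb-∈ E x
    g-∈ (suc i , x) = ∧-left (emb-∈ E′ (i , x))

  packing⇒contains : ∀ h k {A} → h ≤ k → Packing k A → Contains (copies h F) G
  packing⇒contains h k h≤k P = (λ (i , x) → emb E (inject≤ i h≤k , x)) , (λ {x} {y} → inj′ x y) , hom
    where
    E = packing⇒embedding k P
    inj′ : ∀ (x y : Fin h × Fin (suc m)) → emb E (inject≤ (proj₁ x) h≤k , proj₂ x) ≡ emb E (inject≤ (proj₁ y) h≤k , proj₂ y) → x ≡ y
    inj′ (i , x) (j , y) e = cong₂ _,_ (inject≤-injective h≤k h≤k i j (cong proj₁ (emb-inj E e))) (cong proj₂ (emb-inj E e))
    hom : ∀ (x y : Fin h × Fin (suc m)) → adj (copies h F) x y ≡ true →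
      adj G (emb E (inject≤ (proj₁ x) h≤k , proj₂ x)) (emb E (inject≤ (proj₁ y) h≤k , proj₂ y)) ≡ true
    hom (i , x) (j , y) e with refl ← eqᶠ⇒≡ i j (∧-left e) = emb-hom E _ _ (∧-intro (eqᶠ-refl _) (∧-right {eqᶠ i i} e))

  -- Greedy packing; the case distinction on whether A still contains a copy is available under double negation.
  maximal-packing : ∀ d A → ¬ Packing d A →
    ¬ ¬ (Σ ℕ λ c → Σ (Packing c A) λ P → ¬ Embedding F G (rest c P))
  maximal-packing zero    A none k = none tt
  maximal-packing (suc d) A none k = k (zero , tt , λ E →
    maximal-packing d (A ∖ image (emb E)) (λ P → none (E , P)) (λ (c , P , free) → k (suc c , (E , P) , free)))

-- Density conditions and the arithmetic of the exchange

sparse-⊆ : ∀ {n} (G : Graph (Fin n)) {S S′ : Sub n} {μ} → S′ ⊆ S → Sparse G S μ → Sparse G S′ μ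
sparse-⊆ G {S} {S′} sub sparse x x∈ =
  ≤-trans (#-mono {P = λ y → S′ y ∧ not (adj G x y)} {λ y → S y ∧ not (adj G x y)}
    (λ y e → ∧-intro (sub y (∧-left e)) (∧-right e))) (sparse x (sub x x∈))

-- As d ≤ n ≤ (q + 1) e, the surplus e of d over a is at least the fraction d / (q + 1) demanded by
-- Erdős-Stone.
dense-arith : ∀ q a d n e → a + e ≤ d → d ≤ n → n ≤ suc q * e → suc q * a + d ≤ suc q * d
dense-arith q a d n e h₁ h₂ h₃ = begin
  suc q * a + d           ≤⟨ +-monoʳ-≤ (suc q * a) (≤-trans h₂ h₃) ⟩
  suc q * a + suc q * e   ≡⟨ *-distribˡ-+ (suc q) a e ⟨
  suc q * (a + e)         ≤⟨ *-monoʳ-≤ (suc q) h₁ ⟩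
  suc q * d               ∎
  where open ≤-Reasoning

#-∩-≥ : ∀ {n} (P S : Sub n) e → n ≤ # S + e → # P ≤ # (P ∩ S) + e
#-∩-≥ {n} P S e large = begin
  # P                    ≡⟨ #-split P S ⟩
  # (P ∩ S) + # (P ∖ S)  ≤⟨ +-monoʳ-≤ (# (P ∩ S)) (#-mono {P = P ∖ S} {not ∘ S} (λ x → ∧-right)) ⟩
  # (P ∩ S) + # (not ∘ S) ≤⟨ +-monoʳ-≤ (# (P ∩ S)) (+-cancelˡ-≤ (# S) _ _ (subst (_≤ # S + e) (sym (#-compl S)) large)) ⟩
  # (P ∩ S) + e          ∎
  where open ≤-Reasoning

-- How many times n must exceed the error unit e for replace-arith to contradict its hypotheses.
thresholdFactor : ℕ → ℕ → ℕ
thresholdFactor r f = (r * suc r + 3 * suc r) + 1 + f * (f + suc f * (2 + suc r) + 2 * r + (r * suc r + 3 * suc r))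

-- Read s, z, b, ρ, c, w as the sizes of S′, Z, B, R, X without R, and the complement of W, and f as
-- |F|. Up to multiples of e, the old degrees r μ + 3e are at most and z is at least (1 - 1/(r + 1))
-- n. Hence h₁ bounds ρ gains of n / (r + 1) by the errors of x vertices, and x ≤ f ρ leaves n at
-- most a multiple of e.
replace-arith : ∀ r f q n e μ s z b ρ c w → let R = suc r ; M = suc q ; x = ρ + c in
  (b + ρ) * w + c * z ≤ b * n + x * (r * μ + 3 * e) →
  n ≤ w + (b + x) → x ≤ f * ρ → 1 ≤ ρ →
  R * (M * s) + s * (M * suc f) ≤ s * (M + f) + R * (M * suc f * μ) + R * (M * z) →
  n ≤ s + 2 * e → s ≤ M * e → R * μ ≤ n + R * e → R * ((b + ρ) * (b + x)) ≤ e →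
  n ≤ thresholdFactor r f * e
replace-arith r f q n e μ s z b ρ@(suc _) c w h₁ h₂ h₃ h₄ h₅ h₆ h₇ h₈ h₉ = *-cancelˡ-≤ ρ (begin
    ρ * n                                                        ≤⟨ stepD ⟩
    ρ * (lam * e) + e + c * (kap * e)                            ≤⟨ +-mono-≤ (+-monoʳ-≤ (ρ * (lam * e)) (m≤n*m e ρ)) (*-monoˡ-≤ (kap * e) (≤-trans (m≤n+m c ρ) h₃)) ⟩
    ρ * (lam * e) + ρ * e + f * ρ * (kap * e)                    ≡⟨ ring ρ lam e f kap ⟩
    ρ * ((lam + 1 + f * kap) * e)                                ∎)
  where
  open ≤-Reasoning
  g = suc f
  R = suc r
  M = suc q
  D = r * μ + 3 * e
  lam = r * R + 3 * R
  kap₀ = f + g * (2 + R)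
  kap = kap₀ + 2 * r + lam
  ring : ∀ ρ l e f k → ρ * (l * e) + ρ * e + f * ρ * (k * e) ≡ ρ * ((l + 1 + f * k) * e)
  ring = solve-∀
  -- A clone's neighbourhood is large: after division by the number M of blocks, s ≤ M e turns the
  -- term s f of h₅ into f e.
  stepA : r * s ≤ kap₀ * e + R * z
  stepA = linear (+-mono-≤ divided (*-monoʳ-≤ g (≤-trans h₈ (+-monoˡ-≤ (R * e) h₆)))) 0 (ringA r s g f e z μ)
    where
    divided : suc r * s + s * g ≤ s + f * e + g * (suc r * μ) + suc r * z
    divided = *-cancelˡ-≤ M (begin
      M * (R * s + s * g)                                   ≡⟨ ring₁ M R s g ⟩
      R * (M * s) + s * (M * g)                             ≤⟨ h₅ ⟩
      s * (M + f) + R * (M * g * μ) + R * (M * z)           ≡⟨ ring₂ s M f R g μ z ⟩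
      s * f + M * (s + g * (R * μ) + R * z)                 ≤⟨ +-monoˡ-≤ _ (*-monoˡ-≤ f h₇) ⟩
      M * e * f + M * (s + g * (R * μ) + R * z)             ≡⟨ ring₃ s M f R g μ z e ⟩
      M * (s + f * e + g * (R * μ) + R * z)                 ∎)
      where
      ring₁ : ∀ M R s g → M * (R * s + s * g) ≡ R * (M * s) + s * (M * g)
      ring₁ = solve-∀
      ring₂ : ∀ s M f R g μ z → s * (M + f) + R * (M * g * μ) + R * (M * z) ≡ s * f + M * (s + g * (R * μ) + R * z)
      ring₂ = solve-∀
      ring₃ : ∀ s M f R g μ z e → M * e * f + M * (s + g * (R * μ) + R * z) ≡ M * (s + f * e + g * (R * μ) + R * z)
      ring₃ = solve-∀
    ringA : ∀ r s g f e z μ → r * s + (s + f * e + g * (suc r * μ) + suc r * z + g * (s + 2 * e + suc r * e)) + 0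
      ≡ (f + g * (2 + suc r)) * e + suc r * z + (suc r * s + s * g + g * (suc r * μ))
    ringA = solve-∀
  stepC′ : R * D ≤ r * n + lam * e
  stepC′ = linear (*-monoʳ-≤ r h₈) 0 (ringC r μ e n)
    where
    ringC : ∀ r μ e n → suc r * (r * μ + 3 * e) + r * (n + suc r * e) + 0 ≡ r * n + (r * suc r + 3 * suc r) * e + r * (suc r * μ)
    ringC = solve-∀
  stepC : R * D ≤ R * z + kap * e
  stepC = linear (+-mono-≤ (+-mono-≤ stepC′ stepA) (*-monoʳ-≤ r h₆)) 0 (ringC (R * D) r n lam kap₀ e s (R * z))
    where
    ringC : ∀ RD r n l k e s Rz → RD + (r * n + l * e + (k * e + Rz) + r * (s + 2 * e)) + 0
      ≡ Rz + (k + 2 * r + l) * e + (RD + r * s + r * n)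
    ringC = solve-∀
  -- This is R times h₁. Replacing w by n for the b + ρ universal vertices costs R (b + ρ)(b + x),
  -- which the single e absorbs by h₉.
  stepD : ρ * n ≤ ρ * (lam * e) + e + c * (kap * e)
  stepD = linear (+-mono-≤ (+-mono-≤ (+-mono-≤ (*-monoʳ-≤ R h₁) (*-monoʳ-≤ (R * (b + ρ)) h₂)) (+-mono-≤ h₉ (*-monoʳ-≤ c stepC))) (*-monoʳ-≤ ρ stepC′)) 0
    (ringD r ρ n (lam * e) e c (kap * e) b z D w)
    where
    ringD : ∀ r ρ n le e c ke b z D w →
      ρ * n + (suc r * (b * n + (ρ + c) * D) + suc r * (b + ρ) * (w + (b + (ρ + c))) + (e + c * (suc r * z + ke)) + ρ * (r * n + le)) + 0
      ≡ ρ * le + e + c * ke + (suc r * ((b + ρ) * w + c * z) + suc r * (b + ρ) * n + (suc r * ((b + ρ) * (b + (ρ + c))) + c * (suc r * D)) + ρ * (suc r * D))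
    ringD = solve-∀

-- Extremal graphs have h - 1 universal vertices

insert-elim : ∀ {n} (v : Fin n) X x → x ∈ insert v X → v ≡ x ⊎ x ∈ X
insert-elim v X x p with v ≟ x
... | yes e = inj₁ e
... | no _  = inj₂ p

BlowupFinder : ℕ → ℕ → ℕ → ℕ → Set
BlowupFinder s t q L = ∀ {n} (G : Graph (Fin n)) (S : Sub n) μ →
  Sparse G S μ → suc q * (s * μ) + # S ≤ suc q * # S → L ≤ # S → Blowup G S (suc s) (suc t)

-- After multiplication by r + 1 this amounts to n ≥ (r (r + 1) + 3 (r + 1)) e, the origin of that
-- summand in `thresholdFactor`.
lower-arith : ∀ r f n e μ s → suc r * μ ≤ n + suc r * e → n ≤ s + 2 * e → thresholdFactor r f * e ≤ n → r * μ + e ≤ s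
lower-arith r f n e μ s h₁ h₂ h₃ = *-cancelˡ-≤ (suc r)
  (linear (+-mono-≤ (+-mono-≤ (*-monoʳ-≤ r h₁) (*-monoʳ-≤ (suc r) h₂)) h₃) ((1 + t) * e) (ring r t n e μ s))
  where
  t = f * (f + suc f * (2 + suc r) + 2 * r + (r * suc r + 3 * suc r))
  ring : ∀ r t n e μ s → suc r * (r * μ + e) + (r * (n + suc r * e) + suc r * (s + 2 * e) + n) + (1 + t) * e
    ≡ suc r * s + (r * (suc r * μ) + suc r * n + (r * suc r + 3 * suc r + 1 + t) * e)
  ring = solve-∀

module Structure
  {m} (F : Graph (Fin (suc m))) (u : Fin (suc m)) (r : ℕ) (c : Fin (suc m) → Fin (suc r))
  (proper : ∀ x y → x ≢ u → y ≢ u → adj F x y ≡ true → c x ≢ c y)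
  (h q L₁ L₂ : ℕ)
  (find₁ : BlowupFinder r m q L₁) (find₂ : BlowupFinder r (suc m + q * (2 + m)) q L₂)
  {n} (G : Graph (Fin n)) (extremal : InEX n (copies h F) G)
  (S : Sub n) (e μ : ℕ) (large : n ≤ # S + e) (sparse : Sparse G S μ)
  (Rμ≤ : suc r * μ ≤ n + suc r * e) (n≤ : n ≤ suc q * e) (n> : thresholdFactor r (suc m) * e < n)
  (L₁≤e : L₁ ≤ e) (L₂≤e : L₂ ≤ e) (e-large : suc r * (h * (h + 2 * (h * suc m))) ≤ e)
  where

  open Packings F G

  -- One e for the vertices outside S, one for a set of vertices to be avoided, and one as the
  -- surplus over r μ that `dense-arith` needs in the neighbourhood.
  D : ℕ
  D = r * μ + 3 * e

  embed-big : ∀ v → D ≤ # (adj G v) → ∀ X → # X ≤ e → Embedding F G (insert v ((S ∖ X) ∩ adj G v))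
  embed-big v big X small = embed-at-vertex F u c proper v
    (find₁ G Y μ (sparse-⊆ G (λ x p → ∧-left (∧-left p)) sparse)
      (dense-arith q (r * μ) (# Y) n e lower (#≤n Y) n≤) (≤-trans L₁≤e (≤-trans (m≤n+m e (r * μ)) lower)))
    where
    Y = (S ∖ X) ∩ adj G v
    degree : # (adj G v) ≤ # Y + e + e
    degree = begin
      # (adj G v)                     ≤⟨ #-∖ (adj G v) X ⟩
      # (adj G v ∖ X) + # X           ≤⟨ +-mono-≤ (#-∩-≥ (adj G v ∖ X) S e large) small ⟩
      # ((adj G v ∖ X) ∩ S) + e + e   ≤⟨ +-monoˡ-≤ e (+-monoˡ-≤ e (#-mono {P = (adj G v ∖ X) ∩ S} {Y}
                                           (λ x p → ∧-intro (∧-intro (∧-right {(adj G v ∖ X) x} p) (∧-right {adj G v x} (∧-left p))) (∧-left (∧-left p))))) ⟩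
      # Y + e + e                     ∎
      where open ≤-Reasoning
    lower : r * μ + e ≤ # Y
    lower = linear (≤-trans big degree) 0 (ring (r * μ) e (# Y))
      where
      ring : ∀ a e y → a + e + (y + e + e) + 0 ≡ y + (a + 3 * e)
      ring = solve-∀

  pack-big : ∀ (B : Sub n) → (∀ v → v ∈ B → D ≤ # (adj G v)) → ∀ k A →
    k ≤ # (B ∩ A) → # (not ∘ A) + # B + k * suc m ≤ e → Packing k A
  pack-big B big zero    A _ _ = tt
  pack-big B big (suc k) A many room = let (v , v∈) = pick (B ∩ A) (≤-trans (s≤s z≤n) many) in
    step v v∈ (embed-big v (big v (∧-left v∈)) X X-small)
    where
    X : Sub n
    X = (not ∘ A) ∪ B
    X-small : # X ≤ e
    X-small = ≤-trans (≤-trans (#-∪ (not ∘ A) B) (m≤m+n _ _)) room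
    step : ∀ v → v ∈ B ∩ A → Embedding F G (insert v ((S ∖ X) ∩ adj G v)) → Packing (suc k) A
    step v v∈ E₀ = E , pack-big B big k A′ many′ room′
      where
      ∉X : ∀ x → x ∈ (S ∖ X) ∩ adj G v → x ∈ A × B x ≡ false
      ∉X x p = split (A x) (B x) (∧-right {S x} (∧-left p))
        where
        split : ∀ a b → not (not a ∨ b) ≡ true → a ≡ true × b ≡ false
        split true false _ = refl , refl
      inA : insert v ((S ∖ X) ∩ adj G v) ⊆ A
      inA x p with insert-elim v ((S ∖ X) ∩ adj G v) x p
      ... | inj₁ refl = ∧-right {B v} v∈
      ... | inj₂ p′ = proj₁ (∉X x p′)
      E : Embedding F G A
      E = embedding-mono inA E₀
      A′ = A ∖ image (emb E)
      only-v : ∀ x → x ∈ B → x ∈ image (emb E) → v ≡ x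
      only-v x x∈B hit = let (i , e) = ∈-image (emb E) x hit in
        resolve (insert-elim v ((S ∖ X) ∩ adj G v) x (subst (_∈ insert v ((S ∖ X) ∩ adj G v)) e (emb-∈ E₀ i)))
        where
        resolve : v ≡ x ⊎ x ∈ (S ∖ X) ∩ adj G v → v ≡ x
        resolve (inj₁ p) = p
        resolve (inj₂ p) = ⊥-elim (true≢false x∈B (proj₂ (∉X x p)))
      many′ : k ≤ # (B ∩ A′)
      many′ = ≤-trans (≤-pred (subst (suc k ≤_) (#-remove (B ∩ A) v v∈) many))
        (#-mono {P = remove (B ∩ A) v} {B ∩ A′} (λ x p → ∧-intro {B x} (∧-left (∧-left {(B ∩ A) x} p)) (∧-intro (∧-right {B x} (∧-left {(B ∩ A) x} p))
          (not-intro (≢true⇒false (λ hit → true≢false (trans (cong (eqᶠ v) (sym (only-v x (∧-left (∧-left {(B ∩ A) x} p)) hit))) (eqᶠ-refl v)) (not-elim (∧-right {(B ∩ A) x} p))))))))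
      not-A′ : # (not ∘ A′) ≤ # (not ∘ A) + suc m
      not-A′ = ≤-trans (≤-trans (#-mono {P = not ∘ A′} {(not ∘ A) ∪ image (emb E)} (λ x → split (A x) (image (emb E) x)))
                 (#-∪ (not ∘ A) (image (emb E)))) (+-monoʳ-≤ _ (#-image (emb E)))
        where
        split : ∀ a b → not (a ∧ not b) ≡ true → not a ∨ b ≡ true
        split true  true  _ = refl
        split false b     _ = refl
      room′ : # (not ∘ A′) + # B + k * suc m ≤ e
      room′ = linear (+-mono-≤ not-A′ room) 0 (ring (# (not ∘ A′)) (# (not ∘ A)) (# B) k (suc m) e)
        where
        ring : ∀ x y b k f e → x + b + k * f + (y + f + e) + 0 ≡ e + (x + (y + b + suc k * f))
        ring = solve-∀

  -- Otherwise making B ∪ R universal and the vertices of X ∖ R clones would improve G.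
  improve : ∀ (B X R : Sub n) → R ⊆ X → (∀ x → x ∈ B → X x ≡ false) → # B + # R < h → 1 ≤ # R →
    # X ≤ suc m * # R → (∀ x → x ∈ X → # (adj G x) ≤ D) → ¬ Embedding F G (not ∘ (B ∪ X)) → ⊥
  improve B X R R⊆X disjoint few 1≤R X≤ small free = <⇒≱ n> (replace-arith r (suc m) q n e μ (# S′) (# Z) (# B) (# R) (# (X ∖ R)) (# (not ∘ W))
      (subst (λ k → (# B + # R) * # (not ∘ W) + # (X ∖ R) * # Z ≤ # B * n + k * D) X≡
        (arcs-replace G B X R Z D R⊆X disjoint (λ z z∈ → not-elim (∧-right {S z} (Z⊆ z z∈))) small not-better))
      n≤w (subst (_≤ suc m * # R) X≡ X≤) 1≤R bound
      S′-large (≤-trans (#≤n S′) n≤) Rμ≤ const)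
    where
    W = B ∪ X
    S′ = S ∖ W
    X≡ : # X ≡ # R + # (X ∖ R)
    X≡ = trans (#-split X R) (cong (_+ # (X ∖ R)) (≤-antisym (#-mono {P = X ∩ R} {R} (λ x → ∧-right))
           (#-mono {P = R} {X ∩ R} (λ x p → ∧-intro (R⊆X x p) p))))
    W≤ : # W ≤ # B + # X
    W≤ = #-∪ B X
    n≤w : n ≤ # (not ∘ W) + (# B + (# R + # (X ∖ R)))
    n≤w = begin
      n                                              ≡⟨ #-compl W ⟨
      # W + # (not ∘ W)                              ≤⟨ +-monoˡ-≤ (# (not ∘ W)) W≤ ⟩
      # B + # X + # (not ∘ W)                        ≡⟨ +-comm (# B + # X) (# (not ∘ W)) ⟩
      # (not ∘ W) + (# B + # X)                      ≡⟨ cong (λ k → # (not ∘ W) + (# B + k)) X≡ ⟩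
      # (not ∘ W) + (# B + (# R + # (X ∖ R)))        ∎
      where open ≤-Reasoning
    BX≤ : # B + # X ≤ h + 2 * (h * suc m)
    BX≤ = +-mono-≤ (≤-trans (m≤m+n (# B) (# R)) (<⇒≤ few))
      (≤-trans X≤ (≤-trans (subst (_≤ h * suc m) (*-comm (# R) (suc m)) (*-monoˡ-≤ (suc m) (≤-trans (m≤n+m (# R) (# B)) (<⇒≤ few)))) (m≤m+n _ _)))
    const : suc r * ((# B + # R) * (# B + (# R + # (X ∖ R)))) ≤ e
    const = ≤-trans (*-monoʳ-≤ (suc r) (*-mono-≤ (<⇒≤ few) (subst (λ k → # B + k ≤ h + 2 * (h * suc m)) X≡ BX≤))) e-large
    h≥1 : 1 ≤ h
    h≥1 = ≤-trans (s≤s z≤n) few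
    W≤e : # W ≤ e
    W≤e = ≤-trans W≤ (≤-trans BX≤ (≤-trans (≤-trans (m≤n*m (h + 2 * (h * suc m)) h {{>-nonZero h≥1}}) (m≤n*m _ (suc r))) e-large))
    S′-large : n ≤ # S′ + 2 * e
    S′-large = linear (+-mono-≤ (+-mono-≤ large (#-∖ S W)) W≤e) 0 (ring n (# S) (# S′) (# W) e)
      where
      ring : ∀ n s s′ w e → n + (s + e + (s′ + w) + e) + 0 ≡ s′ + 2 * e + (n + s + w)
      ring = solve-∀
    sparse′ : Sparse G S′ μ
    sparse′ = sparse-⊆ G (λ x → ∧-left) sparse
    lower : r * μ + e ≤ # S′
    lower = lower-arith r (suc m) n e μ (# S′) Rμ≤ S′-large (<⇒≤ n>)
    -- Each part consists of q + 1 blocks of m + 2 = |F| + 1 vertices, the number that `clone-free`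
    -- requires.
    K : Blowup G S′ (suc r) (suc q * (2 + m))
    K = find₂ G S′ μ sparse′ (dense-arith q (r * μ) (# S′) n e lower (#≤n S′) n≤) (≤-trans L₂≤e (≤-trans (m≤n+m e (r * μ)) lower))
    -- A vertex with |F| neighbours in every part would complete a copy of F outside W.
    no-good : ∀ v → v ∈ S′ → ¬ (∀ i → suc m ≤ Good.nbrs K (suc m) v i)
    no-good v v∈ good = free (embedding-mono sub (embed-at-vertex F u c proper v (restrict-blowup K (suc m) v good)))
      where
      sub : insert v (S′ ∩ adj G v) ⊆ (not ∘ W)
      sub x p with insert-elim v (S′ ∩ adj G v) x p
      ... | inj₁ refl = ∧-right {S v} v∈
      ... | inj₂ p′ = ∧-right {S x} (∧-left p′)
    found = CommonNbrs.common-nbrs K (suc m) no-good μ sparse′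
    A = proj₁ found
    Z = proj₁ (proj₂ found)
    Z⊆ = proj₁ (proj₂ (proj₂ found))
    bound = proj₂ (proj₂ (proj₂ (proj₂ found)))
    outside : ∀ x → x ∈ S′ → ((not ∘ (B ∪ R)) ∖ (X ∖ R)) x ≡ true
    outside x p = split (B x) (X x) (R x) (∧-right {S x} p) (R⊆X x)
      where
      split : ∀ b y d → not (b ∨ y) ≡ true → (d ≡ true → y ≡ true) → not (b ∨ d) ∧ not (y ∧ not d) ≡ true
      split false false true  _ h = ⊥-elim (true≢false (h refl) refl)
      split false false false _ h = refl
    inside : ((not ∘ (B ∪ R)) ∖ (X ∖ R)) ⊆ (not ∘ W)
    inside x = split (B x) (X x) (R x)
      where
      split : ∀ b y d → not (b ∨ d) ∧ not (y ∧ not d) ≡ true → not (b ∨ y) ≡ true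
      split false false d     _ = refl
      split false true  true  ()
      split false true  false ()
    G′ = univ (clone G (X ∖ R) Z) (B ∪ R)
    not-better : arcs G′ ≤ arcs G
    not-better = edges-mono⇒arcs G′ G (proj₂ extremal G′
      (univ-free F h (clone G (X ∖ R) Z) (B ∪ R) (≤-<-trans (#-∪ B R) few)
        (clone-free F G (X ∖ R) Z (not ∘ (B ∪ R)) (record { at = at A ; at-inj = at-inj A ; at-∈ = λ i → outside _ (at-∈ A i) })
          (proj₁ (proj₂ (proj₂ (proj₂ found)))) (λ E → free (embedding-mono inside E)))))

  big : Sub n
  big v = does (D ≤? # (adj G v))

  big-degree : ∀ v → v ∈ big → D ≤ # (adj G v)
  big-degree v = does-true (D ≤? # (adj G v))

  small-degree : ∀ v → big v ≡ false → # (adj G v) ≤ D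
  small-degree v p = <⇒≤ (≰⇒> (does-false (D ≤? # (adj G v)) p))

  h≤e : h + 2 * (h * suc m) ≤ e
  h≤e = ≤-trans (shape h (suc m)) (≤-trans (m≤n*m _ (suc r)) e-large)
    where
    shape : ∀ k f → k + 2 * (k * f) ≤ k * (k + 2 * (k * f))
    shape zero    f = z≤n
    shape (suc k) f = m≤n*m _ (suc k)

  few-big : # big < h
  few-big = ≰⇒> λ h≤ → let (B , B⊆ , size) = subset-of-size h big h≤ in
    proj₁ extremal (packing⇒contains h h ≤-refl (pack-big B (λ v p → big-degree v (B⊆ v p)) h full
      (≤-reflexive (sym (trans (#-cong {P = B ∩ full} {B} (λ x → Bool.∧-identityʳ (B x))) size)))
      (≤-trans (≤-reflexive (cong₂ (λ a b → a + b + h * suc m) (trans (sum-const n 0) (*-zeroʳ n)) size)) (≤-trans (+-monoʳ-≤ h (m≤m+n (h * suc m) _)) h≤e))))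

  n>h : h < n
  n>h = ≤-<-trans (≤-trans (m≤m+n h _) h≤e) (≤-<-trans (m≤n*m e (thresholdFactor r (suc m)) {{nz}}) n>)
    where
    nz : NonZero (thresholdFactor r (suc m))
    nz = >-nonZero (≤-trans (m≤n+m 1 (r * suc r + 3 * suc r)) (m≤m+n (r * suc r + 3 * suc r + 1) _))

  -- The packing leaves every big vertex available to carry a copy of its own, so all these copies
  -- together must number fewer than h.
  packing-bound : ∀ k (P : Packing k (not ∘ big)) → k + # big < h
  packing-bound k P = ≰⇒> λ h≤ → proj₁ extremal (packing⇒contains h (k + # big) h≤ (append k (# big) P′ (pack h≤)))
    where
    P′ : Packing k full
    P′ = packing-mono k (λ _ _ → refl) P
    A = rest k P′
    k≤h : k ≤ h
    k≤h = ≮⇒≥ (λ lt → proj₁ extremal (packing⇒contains h k (<⇒≤ lt) P))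
    used : # (not ∘ A) ≤ k * suc m
    used = +-cancelˡ-≤ (# A) _ _ (subst (_≤ # A + k * suc m) (trans (#-full n) (sym (#-compl A))) (rest-large k P′))
    pack : h ≤ k + # big → Packing (# big) A
    pack h≤ = pack-big big big-degree (# big) A
      (#-mono {P = big} {big ∩ A} (λ x p → ∧-intro p (rest-mono k (λ _ _ → refl) P x refl (cong not p)))) room
      where
      room : # (not ∘ A) + # big + # big * suc m ≤ e
      room = ≤-trans (+-mono-≤ (+-mono-≤ (≤-trans used (*-monoˡ-≤ (suc m) k≤h)) (<⇒≤ few-big)) (*-monoˡ-≤ (suc m) (<⇒≤ few-big)))
        (≤-trans (≤-reflexive (ring h (h * suc m))) h≤e)
        where
        ring : ∀ h x → x + h + x ≡ h + 2 * x
        ring = solve-∀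

  -- X is the set covered by the packing, R any k + 1 of its vertices. `packing-bound` leaves room
  -- for R among the universal vertices, and X has at most |F| vertices per member of R.
  no-packing : ∀ k (P : Packing (suc k) (not ∘ big)) → ¬ Embedding F G (rest (suc k) P) → ⊥
  no-packing k P free = extract (subset-of-size (suc k) X X-large)
    where
    A = rest (suc k) P
    X : Sub n
    X = (not ∘ big) ∖ A
    split-size : # (not ∘ big) ≡ # A + # X
    split-size = trans (#-split (not ∘ big) A) (cong (_+ # X) (≤-antisym (#-mono {P = (not ∘ big) ∩ A} {A} (λ x → ∧-right))
      (#-mono {P = A} {(not ∘ big) ∩ A} (λ x p → ∧-intro (rest-⊆ (suc k) P x p) p))))
    X-large : suc k ≤ # X
    X-large = +-cancelˡ-≤ (# A) _ _ (≤-trans (rest-small (suc k) P) (≤-reflexive split-size))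
    X-small : # X ≤ suc k * suc m
    X-small = +-cancelˡ-≤ (# A) _ _ (≤-trans (≤-reflexive (sym split-size)) (rest-large (suc k) P))
    extract : Σ (Sub n) (λ R → R ⊆ X × # R ≡ suc k) → ⊥
    extract (R , R⊆X , size) = improve big X R R⊆X (λ x p → cong (λ b → not b ∧ not (A x)) p)
      (subst (_< h) (trans (+-comm (suc k) (# big)) (cong (# big +_) (sym size))) (packing-bound (suc k) P))
      (subst (1 ≤_) (sym size) (s≤s z≤n))
      (subst (# X ≤_) (trans (*-comm (suc k) (suc m)) (cong (suc m *_) (sym size))) X-small)
      (λ x p → small-degree x (not-elim (∧-left p)))
      (λ E → free (embedding-mono (λ x → split (big x) (A x)) E))
      where
      split : ∀ b a → not (b ∨ (not b ∧ not a)) ≡ true → a ≡ true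
      split false true  _ = refl
      split false false ()
      split true  _     ()

  -- The goal is a negation, so the double negation in `maximal-packing` is harmless.
  free-outside-big : ¬ Embedding F G (not ∘ big)
  free-outside-big E = maximal-packing h (not ∘ big) (λ P → proj₁ extremal (packing⇒contains h h ≤-refl P)) λ
    { (zero  , P , free) → free E
    ; (suc k , P , free) → no-packing k P free }

  -- With fewer than h - 1 big vertices, any small vertex v could be made universal: `improve` with
  -- X = R = {v}, where nothing is cloned.
  #big : # big ≡ h ∸ 1
  #big = ≤-antisym (<⇒≤pred few-big) (≮⇒≥ one-more)
    where
    one-more : # big < h ∸ 1 → ⊥
    one-more lt = extend (pick (not ∘ big) (+-cancelˡ-≤ (# big) _ _
        (≤-trans (≤-reflexive (+-comm (# big) 1)) (≤-trans few-big (≤-trans (<⇒≤ n>h) (≤-reflexive (sym (#-compl big))))))))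
      where
      extend : (∃ λ v → v ∈ (not ∘ big)) → ⊥
      extend (v , v∉) = improve big (eqᶠ v) (eqᶠ v) (λ _ p → p)
        (λ x p → eqᶠ-≢ v x (λ { refl → true≢false p (not-elim v∉) }))
        (subst (λ k → # big + k < h) (sym (singleton-sum v)) (subst (_< h) (+-comm 1 (# big)) (≤-trans (s≤s lt) (suc-pred-≤ h (≤-trans (s≤s z≤n) few-big)))))
        (≤-reflexive (sym (singleton-sum v)))
        (subst (λ k → k ≤ suc m * k) (sym (singleton-sum v)) (s≤s z≤n))
        (λ x p → small-degree x (subst (λ y → big y ≡ false) (eqᶠ⇒≡ v x p) (not-elim v∉)))
        (λ E → free-outside-big (embedding-mono (λ x → split (big x) (eqᶠ v x)) E))
        where
        split : ∀ a b → not (a ∨ b) ≡ true → not a ≡ true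
        split false b _ = refl
        suc-pred-≤ : ∀ h → 1 ≤ h → suc (h ∸ 1) ≤ h
        suc-pred-≤ (suc h) _ = ≤-refl

  big-universal : ∀ x y → x ∈ big → x ≢ y → adj G x y ≡ true
  big-universal x y x∈ x≢y with adj G x y in eq
  ... | true  = refl
  ... | false = ⊥-elim (<⇒≱ more (edges-mono⇒arcs (univ G big) G (proj₂ extremal (univ G big)
                  (univ-free F h G big few-big free-outside-big))))
    where
    more : arcs G < arcs (univ G big)
    more = sum-mono-< (λ a → #-mono {P = adj G a} {adj (univ G big) a} (λ b → univ-⊇ G big a b)) x
      (sum-mono-< (λ b → ind-mono (univ-⊇ G big x b)) y
        (subst₂ (λ a b → ind a < ind b) (sym eq) (sym (univ-inside G big x y x∈ x≢y)) (s≤s z≤n)))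

-- Joins with a complete graph

record Splitting {n} (B : Sub n) (a b : ℕ) : Set where
  field
    bij     : Fin n ↔ (Fin a ⊎ Fin b)
    left-∈  : ∀ i → Inverse.from bij (inj₁ i) ∈ B
    right-∉ : ∀ j → B (Inverse.from bij (inj₂ j)) ≡ false

open Splitting public

splitting : ∀ {n} (B : Sub n) → Splitting B (# B) (# (not ∘ B))
splitting {zero} B = record
  { bij = mk↔ₛ′ (λ ()) (λ { (inj₁ ()) ; (inj₂ ()) }) (λ { (inj₁ ()) ; (inj₂ ()) }) (λ ())
  ; left-∈ = λ () ; right-∉ = λ () }
splitting {suc n} B with B zero in eq | splitting (B ∘ suc)
... | true | σ = record
  { bij = mk↔ₛ′ to′ from′ inv₁ inv₂ ; left-∈ = λ { zero → eq ; (suc i) → left-∈ σ i } ; right-∉ = right-∉ σ }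
  where
  open Inverse (bij σ)
  to′ : Fin (suc n) → Fin (suc (# (B ∘ suc))) ⊎ Fin (# (not ∘ B ∘ suc))
  to′ zero    = inj₁ zero
  to′ (suc x) = Sum.map₁ suc (to x)
  from′ : Fin (suc (# (B ∘ suc))) ⊎ Fin (# (not ∘ B ∘ suc)) → Fin (suc n)
  from′ (inj₁ zero)    = zero
  from′ (inj₁ (suc i)) = suc (from (inj₁ i))
  from′ (inj₂ j)       = suc (from (inj₂ j))
  inv₁ : ∀ z → to′ (from′ z) ≡ z
  inv₁ (inj₁ zero)    = refl
  inv₁ (inj₁ (suc i)) = cong (Sum.map₁ suc) (strictlyInverseˡ (inj₁ i))
  inv₁ (inj₂ j)       = cong (Sum.map₁ suc) (strictlyInverseˡ (inj₂ j))
  inv₂ : ∀ x → from′ (to′ x) ≡ x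
  inv₂ zero    = refl
  inv₂ (suc x) = trans (shift (to x)) (cong suc (strictlyInverseʳ x))
    where
    shift : ∀ z → from′ (Sum.map₁ suc z) ≡ suc (from z)
    shift (inj₁ i) = refl
    shift (inj₂ j) = refl
... | false | σ = record
  { bij = mk↔ₛ′ to′ from′ inv₁ inv₂ ; left-∈ = left-∈ σ ; right-∉ = λ { zero → eq ; (suc j) → right-∉ σ j } }
  where
  open Inverse (bij σ)
  to′ : Fin (suc n) → Fin (# (B ∘ suc)) ⊎ Fin (suc (# (not ∘ B ∘ suc)))
  to′ zero    = inj₂ zero
  to′ (suc x) = Sum.map₂ suc (to x)
  from′ : Fin (# (B ∘ suc)) ⊎ Fin (suc (# (not ∘ B ∘ suc))) → Fin (suc n)
  from′ (inj₁ i)       = suc (from (inj₁ i))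
  from′ (inj₂ zero)    = zero
  from′ (inj₂ (suc j)) = suc (from (inj₂ j))
  inv₁ : ∀ z → to′ (from′ z) ≡ z
  inv₁ (inj₁ i)       = cong (Sum.map₂ suc) (strictlyInverseˡ (inj₁ i))
  inv₁ (inj₂ zero)    = refl
  inv₁ (inj₂ (suc j)) = cong (Sum.map₂ suc) (strictlyInverseˡ (inj₂ j))
  inv₂ : ∀ x → from′ (to′ x) ≡ x
  inv₂ zero    = refl
  inv₂ (suc x) = trans (shift (to x)) (cong suc (strictlyInverseʳ x))
    where
    shift : ∀ z → from′ (Sum.map₂ suc z) ≡ suc (from z)
    shift (inj₁ i) = refl
    shift (inj₂ j) = refl

pull : ∀ {V W : Set} → (V → W) → Graph W → Graph V
pull f G = record
  { adj = λ x y → adj G (f x) (f y) ; adjSym = λ x y → adjSym G (f x) (f y) ; adjIrr = λ x → adjIrr G (f x) }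

sum-bij : ∀ {n a b} (σ : Fin n ↔ (Fin a ⊎ Fin b)) (f : Fin a ⊎ Fin b → ℕ) →
  sum (f ∘ Inverse.to σ) ≡ sum (f ∘ inj₁) + sum (f ∘ inj₂)
sum-bij {n} {a} {b} σ f = begin
  sum (f ∘ Inverse.to σ)
    ≡⟨ sum-cong-≗ (λ x → cong f (sym (splitAt-join a b (Inverse.to σ x)))) ⟩
  sum (λ x → f (splitAt a (Inverse.to π x)))
    ≡⟨ sum-permute (f ∘ splitAt a) π ⟨
  sum (f ∘ splitAt a)
    ≡⟨ sum-++ a (f ∘ splitAt a) ⟩
  sum (λ i → f (splitAt a (i ↑ˡ b))) + sum (λ j → f (splitAt a (a ↑ʳ j)))
    ≡⟨ cong₂ _+_ (sum-cong-≗ (λ i → cong f (splitAt-↑ˡ a i b))) (sum-cong-≗ (λ j → cong f (splitAt-↑ʳ a b j))) ⟩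
  sum (f ∘ inj₁) + sum (f ∘ inj₂) ∎
  where
  open ≡-Reasoning
  π : Fin n ↔ Fin (a + b)
  π = mk↔ₛ′ (joinᶠ a b ∘ Inverse.to σ) (Inverse.from σ ∘ splitAt a)
    (λ k → trans (cong (joinᶠ a b) (Inverse.strictlyInverseˡ σ (splitAt a k))) (join-splitAt a b k))
    (λ x → trans (cong (Inverse.from σ) (splitAt-join a b (Inverse.to σ x))) (Inverse.strictlyInverseʳ σ x))

twice-C2 : ∀ a → (a choose 2) + (a choose 2) + a ≡ a * a
twice-C2 zero = refl
twice-C2 (suc a) = begin
  suc a choose 2 + suc a choose 2 + suc a            ≡⟨ cong (λ k → k + k + suc a) (trans (sym (nCk+nC[k+1]≡[n+1]C[k+1] a 1)) (cong (_+ a choose 2) (nC1≡n a))) ⟩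
  (a + a choose 2) + (a + a choose 2) + suc a        ≡⟨ ring₁ a (a choose 2) ⟩
  (a choose 2 + a choose 2 + a) + (a + suc a)        ≡⟨ cong (_+ (a + suc a)) (twice-C2 a) ⟩
  a * a + (a + suc a)                      ≡⟨ ring₂ a ⟩
  suc a * suc a                            ∎
  where
  open ≡-Reasoning
  ring₁ : ∀ a c → (a + c) + (a + c) + suc a ≡ (c + c + a) + (a + suc a)
  ring₁ = solve-∀
  ring₂ : ∀ a → a * a + (a + suc a) ≡ suc a * suc a
  ring₂ = solve-∀

joinK : ∀ {n a b} → Fin n ↔ (Fin a ⊎ Fin b) → Graph (Fin b) → Graph (Fin n)
joinK {a = a} σ H = pull (Inverse.to σ) (join (complete a) H)

halve-≡ : ∀ {a b} → a + a ≡ b + b → a ≡ b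
halve-≡ e = ≤-antisym (halve-≤ (≤-reflexive e)) (halve-≤ (≤-reflexive (sym e)))

-- Arcs are counted by rows on the two sides; adding the a diagonal pairs completes the arcs of the
-- complete graph to a².
edgeCount-joinK : ∀ {n a b} (σ : Fin n ↔ (Fin a ⊎ Fin b)) (H : Graph (Fin b)) →
  edgeCount (joinK σ H) ≡ a choose 2 + a * b + edgeCount H
edgeCount-joinK {n} {a} {b} σ H = halve-≡ (+-cancelʳ-≡ a _ _ (begin
  edgeCount Jσ + edgeCount Jσ + a
    ≡⟨ cong (_+ a) (arcs≡2*edges Jσ) ⟨
  arcs Jσ + a
    ≡⟨ cong (_+ a) (trans (sum-cong-≗ (λ x → sum-bij σ (λ w → ind (adj J₀ (Inverse.to σ x) w)))) (sum-bij σ row)) ⟩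
  sum (row ∘ inj₁) + sum (row ∘ inj₂) + a
    ≡⟨ cong₂ (λ s t → s + t + a) left right ⟩
  (loops + a * b) + (b * a + arcs H) + a
    ≡⟨ ring₁ loops a b (arcs H) ⟩
  (loops + a) + 2 * (a * b) + arcs H
    ≡⟨ cong₂ (λ s t → s + 2 * (a * b) + t) (trans loops+a (sym (twice-C2 a))) (arcs≡2*edges H) ⟩
  (a choose 2 + a choose 2 + a) + 2 * (a * b) + (edgeCount H + edgeCount H)
    ≡⟨ ring₂ (a choose 2) a (a * b) (edgeCount H) ⟩
  (a choose 2 + a * b + edgeCount H) + (a choose 2 + a * b + edgeCount H) + a ∎))
  where
  open ≡-Reasoning
  Jσ = joinK σ H
  J₀ = join (complete a) H
  row : Fin a ⊎ Fin b → ℕ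
  row w = sum (λ i → ind (adj J₀ w (inj₁ i))) + sum (λ j → ind (adj J₀ w (inj₂ j)))
  degree : Fin a → ℕ
  degree i = # (λ i′ → not (eqᶠ i i′))
  loops = sum degree
  left : sum (row ∘ inj₁) ≡ loops + a * b
  left = trans (∑-distrib-+ {a} degree (λ _ → # (full {b}))) (cong (loops +_) (trans (sum-const a (# (full {b}))) (cong (a *_) (#-full b))))
  right : sum (row ∘ inj₂) ≡ b * a + arcs H
  right = trans (∑-distrib-+ {b} (λ _ → # (full {a})) (λ j → # (adj H j))) (cong (_+ arcs H) (trans (sum-const b (# (full {a}))) (cong (b *_) (#-full a))))
  loops+a : loops + a ≡ a * a
  loops+a = begin
    loops + a                       ≡⟨ cong (loops +_) (#-full a) ⟨
    loops + # (full {a})            ≡⟨ ∑-distrib-+ {a} degree (λ _ → 1) ⟨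
    sum (λ i → degree i + 1)        ≡⟨ sum-cong-≗ {a} (λ i → trans (+-comm (degree i) 1) (trans (cong (_+ degree i) (sym (singleton-sum i))) (#-compl (eqᶠ i)))) ⟩
    sum {a} (λ _ → a)               ≡⟨ sum-const a a ⟩
    a * a                           ∎
  ring₁ : ∀ l a b h → (l + a * b) + (b * a + h) + a ≡ (l + a) + 2 * (a * b) + h
  ring₁ = solve-∀
  ring₂ : ∀ c a p h → (c + c + a) + 2 * p + (h + h) ≡ (c + p + h) + (c + p + h) + a
  ring₂ = solve-∀

isLeft : ∀ {A B : Set} → A ⊎ B → Bool
isLeft (inj₁ _) = true
isLeft (inj₂ _) = false

joinK-free : ∀ {m} (F : Graph (Fin m)) h {n a b} (σ : Fin n ↔ (Fin a ⊎ Fin b)) (H : Graph (Fin b)) →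
  a < h → Free F H → Free (copies h F) (joinK σ H)
joinK-free {m} F h {n} {a} {b} σ H a<h free = copies-free F h (joinK σ H) U (subst (_< h) (sym #U) a<h) λ E → free (restrict E)
  where
  U : Sub n
  U = isLeft ∘ Inverse.to σ
  #U : # U ≡ a
  #U = trans (sum-bij σ (ind ∘ isLeft)) (trans (cong₂ _+_ (#-full a) (trans (sum-const b 0) (*-zeroʳ b))) (+-identityʳ a))
  right : ∀ z → isLeft z ≡ false → Σ (Fin b) λ j → z ≡ inj₂ j
  right (inj₂ j) _ = j , refl
  restrict : Embedding F (joinK σ H) (not ∘ U) → Contains F H
  restrict E = g , (λ {x} {y} → g-inj x y) , g-hom
    where
    at′ : ∀ x → Σ (Fin b) λ j → Inverse.to σ (emb E x) ≡ inj₂ j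
    at′ x = right (Inverse.to σ (emb E x)) (not-elim (emb-∈ E x))
    g : Fin m → Fin b
    g x = proj₁ (at′ x)
    g-inj : ∀ x y → g x ≡ g y → x ≡ y
    g-inj x y e = emb-inj E (to-inj (trans (proj₂ (at′ x)) (trans (cong inj₂ e) (sym (proj₂ (at′ y))))))
      where
      to-inj : ∀ {x y} → Inverse.to σ x ≡ Inverse.to σ y → x ≡ y
      to-inj {x} {y} e = trans (sym (Inverse.strictlyInverseʳ σ x)) (trans (cong (Inverse.from σ) e) (Inverse.strictlyInverseʳ σ y))
    g-hom : ∀ x y → adj F x y ≡ true → adj H (g x) (g y) ≡ true
    g-hom x y e = subst₂ (λ v w → adj (join (complete a) H) v w ≡ true) (proj₂ (at′ x)) (proj₂ (at′ y)) (emb-hom E x y e)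

arcs-cong : ∀ {n} (G G′ : Graph (Fin n)) → (∀ x y → adj G x y ≡ adj G′ x y) → edgeCount G ≡ edgeCount G′
arcs-cong G G′ same = ≤-antisym (arcs-mono⇒edges G G′ (≤-reflexive eq)) (arcs-mono⇒edges G′ G (≤-reflexive (sym eq)))
  where
  eq : arcs G ≡ arcs G′
  eq = sum-cong-≗ (λ x → sum-cong-≗ (λ y → cong ind (same x y)))

JoinStructure : ∀ {m} → Graph (Fin m) → ∀ {n} → Graph (Fin n) → ℕ → ℕ → Set
JoinStructure F G a b = Σ (Graph (Fin b)) λ H → InEX b F H × Isomorphic G (join (complete a) H)

-- H inherits maximality from G: with a competitor H′ in its place the join is still hF-free, and by
-- `edgeCount-joinK` only the edges of H and H′ matter in the comparison.
join-structure : ∀ {m} (F : Graph (Fin m)) h {n} (G : Graph (Fin n)) → InEX n (copies h F) G → ∀ (B : Sub n) {a b} → Splitting B a b →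
  a < h → (∀ x y → x ∈ B → x ≢ y → adj G x y ≡ true) → ¬ Embedding F G (not ∘ B) → JoinStructure F G a b
join-structure F h {n} G extremal B {a} {b} σ a<h universal free = H , (H-free , H-max) , bij σ , iso
  where
  open Inverse (bij σ) using (to; from; strictlyInverseˡ; strictlyInverseʳ)
  from-inj : ∀ {z w} → from z ≡ from w → z ≡ w
  from-inj {z} {w} e = trans (sym (strictlyInverseˡ z)) (trans (cong to e) (strictlyInverseˡ w))
  H : Graph (Fin b)
  H = pull (from ∘ inj₂) G
  H-free : Free F H
  H-free (f , f-inj , f-hom) = free (record
    { emb = from ∘ inj₂ ∘ f ; emb-inj = λ e → f-inj (inj₂-injective (from-inj e)) ; emb-hom = f-hom ; emb-∈ = λ x → not-intro (right-∉ σ (f x)) })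
  inside : ∀ z w → adj G (from z) (from w) ≡ adj (join (complete a) H) z w
  inside (inj₁ i) (inj₁ j) with i ≟ j
  ... | yes refl = adjIrr G _
  ... | no ne = universal _ _ (left-∈ σ i) (λ e → ne (inj₁-injective (from-inj e)))
  inside (inj₁ i) (inj₂ j) = universal _ _ (left-∈ σ i) (λ e → inj₁≢inj₂ (from-inj e))
    where
    inj₁≢inj₂ : _≡_ {A = Fin a ⊎ Fin b} (inj₁ i) (inj₂ j) → ⊥
    inj₁≢inj₂ ()
  inside (inj₂ i) (inj₁ j) = trans (adjSym G _ _) (universal _ _ (left-∈ σ j) (λ e → inj₁≢inj₂ (from-inj e)))
    where
    inj₁≢inj₂ : _≡_ {A = Fin a ⊎ Fin b} (inj₁ j) (inj₂ i) → ⊥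
    inj₁≢inj₂ ()
  inside (inj₂ i) (inj₂ j) = refl
  iso : ∀ x y → adj G x y ≡ adj (join (complete a) H) (to x) (to y)
  iso x y = trans (cong₂ (adj G) (sym (strictlyInverseʳ x)) (sym (strictlyInverseʳ y))) (inside (to x) (to y))
  H-max : ∀ H′ → Free F H′ → edgeCount H′ ≤ edgeCount H
  H-max H′ H′-free = +-cancelˡ-≤ (a choose 2 + a * b) _ _ (begin
    a choose 2 + a * b + edgeCount H′ ≡⟨ edgeCount-joinK (bij σ) H′ ⟨
    edgeCount (joinK (bij σ) H′) ≤⟨ proj₂ extremal (joinK (bij σ) H′) (joinK-free F h (bij σ) H′ a<h H′-free) ⟩
    edgeCount G                  ≡⟨ arcs-cong G (joinK (bij σ) H) iso ⟩
    edgeCount (joinK (bij σ) H)  ≡⟨ edgeCount-joinK (bij σ) H ⟩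
    a choose 2 + a * b + edgeCount H  ∎)
    where open ≤-Reasoning

structure-edges : ∀ {m} (F : Graph (Fin m)) {n} (G : Graph (Fin n)) {a b} x → IsEx b F x → JoinStructure F G a b →
  edgeCount G ≡ a choose 2 + a * b + x
structure-edges F G {a} {b} x (H₀ , (H₀-free , H₀-max) , size) (H , (H-free , H-max) , σ , iso) = begin
  edgeCount G                    ≡⟨ arcs-cong G (joinK σ H) iso ⟩
  edgeCount (joinK σ H)          ≡⟨ edgeCount-joinK σ H ⟩
  a choose 2 + a * b + edgeCount H    ≡⟨ cong (a choose 2 + a * b +_) (trans (≤-antisym (H₀-max H H-free) (H-max H₀ H₀-free)) size) ⟩
  a choose 2 + a * b + x              ∎
  where open ≡-Reasoning

-- The maximum over ℓ

delete-zero : ∀ {n} (G : Graph (Fin (suc n))) → edgeCount G ≤ n + edgeCount (deleteVertex G zero)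
delete-zero {n} G = halve-≤ (begin
  edgeCount G + edgeCount G     ≡⟨ arcs≡2*edges G ⟨
  arcs G                        ≡⟨⟩
  ind (adj G zero zero) + # (adj G zero ∘ suc) + sum (λ x → ind (adj G (suc x) zero) + # (adj G (suc x) ∘ suc))
                                ≡⟨ cong₂ _+_ (cong (λ b → ind b + # (adj G zero ∘ suc)) (adjIrr G zero))
                                     (∑-distrib-+ (λ x → ind (adj G (suc x) zero)) (λ x → # (adj G (suc x) ∘ suc))) ⟩
  # (adj G zero ∘ suc) + (# (λ x → adj G (suc x) zero) + arcs G′)
                                ≤⟨ +-mono-≤ (#≤n (adj G zero ∘ suc)) (+-monoˡ-≤ (arcs G′) (#≤n (λ x → adj G (suc x) zero))) ⟩
  n + (n + arcs G′)             ≡⟨ cong (λ k → n + (n + k)) (arcs≡2*edges G′) ⟩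
  n + (n + (edgeCount G′ + edgeCount G′)) ≡⟨ ring n (edgeCount G′) ⟩
  n + edgeCount G′ + (n + edgeCount G′)   ∎)
  where
  open ≤-Reasoning
  G′ = deleteVertex G zero
  ring : ∀ n g → n + (n + (g + g)) ≡ n + g + (n + g)
  ring = solve-∀

ex-step : ∀ {V : Set} (F : Graph V) n {x y} → IsEx (suc n) F x → IsEx n F y → x ≤ n + y
ex-step F n (G , (G-free , _) , refl) (H , (_ , H-max) , refl) = ≤-trans (delete-zero G)
  (+-monoʳ-≤ n (H-max (deleteVertex G zero) (λ (f , f-inj , f-hom) → G-free (suc ∘ f , (λ e → f-inj (suc-injectiveᶠ e)) , f-hom))))

-- Making one of the N + 1 vertices of the F-free part universal loses nothing, as it had at most N
-- neighbours there.
term-step : ∀ {V : Set} (F : Graph V) exF → (∀ n → IsEx n F (exF n)) → ∀ n ℓ → suc ℓ ≤ n → term exF n (suc ℓ) ≤ term exF n (2 + ℓ)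
term-step F exF isEx n ℓ ℓ<n = subst₂ (λ p q → ℓ choose 2 + ℓ * p + exF p ≤ suc ℓ choose 2 + suc ℓ * q + exF q) (sym size₁) (sym size₂) (begin
  ℓ choose 2 + ℓ * suc N + exF (suc N)           ≤⟨ +-monoʳ-≤ (ℓ choose 2 + ℓ * suc N) (ex-step F N (isEx (suc N)) (isEx N)) ⟩
  ℓ choose 2 + ℓ * suc N + (N + exF N)           ≡⟨ ring (ℓ choose 2) ℓ N (exF N) ⟩
  (ℓ + ℓ choose 2) + suc ℓ * N + exF N           ≡⟨ cong (λ k → k + suc ℓ * N + exF N) (trans (cong (_+ ℓ choose 2) (sym (nC1≡n ℓ))) (nCk+nC[k+1]≡[n+1]C[k+1] ℓ 1)) ⟩
  suc ℓ choose 2 + suc ℓ * N + exF N             ∎)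
  where
  open ≤-Reasoning
  N = n ∸ suc ℓ
  size₁ : (n + 1) ∸ suc ℓ ≡ suc N
  size₁ = trans (cong (_∸ suc ℓ) (+-comm n 1)) (+-∸-assoc 1 ℓ<n)
  size₂ : (n + 1) ∸ (2 + ℓ) ≡ N
  size₂ = cong (_∸ (2 + ℓ)) (+-comm n 1)
  ring : ∀ c l N x → c + l * suc N + (N + x) ≡ (l + c) + suc l * N + x
  ring = solve-∀

maxFrom1-last : ∀ k g → (∀ ℓ → ℓ < k → g (suc ℓ) ≤ g (2 + ℓ)) → maxFrom1 (suc k) g ≡ g (suc k)
maxFrom1-last zero    g mono = refl
maxFrom1-last (suc k) g mono = trans (cong (_⊔ g (2 + k)) (maxFrom1-last k g (λ ℓ lt → mono ℓ (m<n⇒m<1+n lt)))) (m≤n⇒m⊔n≡n (mono k ≤-refl))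

-- Repeated improvement of a graph ends in an extremal one, as the number of edges is bounded.
extremal-bound : ∀ {V : Set} (F : Graph V) n x → (∀ G → InEX n F G → edgeCount G ≡ x) → ∀ G → Free F G → edgeCount G ≤ x
extremal-bound F n x exact G₀ free₀ = ≮⇒≥ (go (n * n) G₀ free₀ (m≤n+m (n * n) _))
  where
  few : ∀ (G : Graph (Fin n)) → edgeCount G ≤ n * n
  few G = ≤-trans (m≤m+n (edgeCount G) (edgeCount G + nonEdges G full))
    (≤-reflexive (trans (sym (+-assoc (edgeCount G) _ _)) (trans (cong (_+ nonEdges G full) (sym (arcs≡2*edges G))) (arcs+nonEdges G))))
  go : ∀ d G → Free F G → n * n ≤ edgeCount G + d → x < edgeCount G → ⊥
  better : ∀ d G → n * n ≤ edgeCount G + d → x < edgeCount G → ∀ G′ → Free F G′ → edgeCount G < edgeCount G′ → ⊥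
  go d G free bound lt = <⇒≢ lt (sym (exact G (free , λ G′ free′ → ≮⇒≥ (better d G bound lt G′ free′))))
  better zero    G bound lt G′ free′ more = <⇒≱ more (≤-trans (few G′) (subst (n * n ≤_) (+-identityʳ _) bound))
  better (suc d) G bound lt G′ free′ more = go d G′ free′
    (≤-trans bound (subst (_≤ edgeCount G′ + d) (sym (+-suc (edgeCount G) d)) (+-monoˡ-≤ d more))) (<-trans lt more)

-- Choice of constants and assembly of the theorem

colour-except : ∀ {m} (F : Graph (Fin (suc m))) u {r} → Colorable (deleteVertex F u) (suc r) →
  Σ (Fin (suc m) → Fin (suc r)) λ c → ∀ x y → x ≢ u → y ≢ u → adj F x y ≡ true → c x ≢ c y
colour-except {m} F u {r} (c , proper) = (λ x → colour x (u ≟ x)) , λ x y p q e → proper′ x y (u ≟ x) (u ≟ y) (p ∘ sym) (q ∘ sym) e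
  where
  -- The vertex u receives a default colour; properness is claimed away from u.
  colour : ∀ x → Dec (u ≡ x) → Fin (suc r)
  colour x (yes _) = zero
  colour x (no ne) = c (punchOut ne)
  proper′ : ∀ x y dx dy → u ≢ x → u ≢ y → adj F x y ≡ true → colour x dx ≢ colour y dy
  proper′ x y (yes p) dy p′ q′ e = ⊥-elim (p′ p)
  proper′ x y (no p) (yes q) p′ q′ e = ⊥-elim (q′ q)
  proper′ x y (no p) (no q) p′ q′ e = proper _ _ (subst₂ (λ v w → adj F v w ≡ true) (sym (punchIn-punchOut p)) (sym (punchIn-punchOut q)) e)

copies-colorable : ∀ {V : Set} (F : Graph V) h {k} → Colorable F k → Colorable (copies h F) k
copies-colorable F h (c , proper) = c ∘ proj₂ , λ (a , x) (b , y) e → proper x y (∧-right {eqᶠ a b} e)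

n/Q≥ : ∀ Q E n → suc Q * E ≤ n → E ≤ n / suc Q
n/Q≥ Q E n h = subst (_≤ n / suc Q) (m*n/n≡m E (suc Q)) (/-monoˡ-≤ (suc Q) (subst (_≤ n) (*-comm (suc Q) E) h))

n<[1+n/Q]*Q : ∀ Q n → n ≤ suc Q * (n / suc Q) + Q
n<[1+n/Q]*Q Q n = begin
  n                                       ≡⟨ m≡m%n+[m/n]*n n (suc Q) ⟩
  n % suc Q + n / suc Q * suc Q           ≤⟨ +-monoˡ-≤ (n / suc Q * suc Q) (≤-pred (m%n<n n (suc Q))) ⟩
  Q + n / suc Q * suc Q                   ≡⟨ trans (+-comm Q _) (cong (_+ Q) (*-comm (n / suc Q) (suc Q))) ⟩
  suc Q * (n / suc Q) + Q                 ∎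
  where open ≤-Reasoning

core-size : ∀ R Q n e L → n ≤ suc Q * e → R * suc Q + L * L + 1 ≤ e → 2 * (R * n) + L * L < 2 * (e * e)
core-size R Q n e@(suc e′) L h₁ h₂ = linear (+-mono-≤ (*-monoʳ-≤ 2 (*-monoʳ-≤ R h₁)) (*-monoʳ-≤ 2 (*-monoʳ-≤ e h₂))) (1 + 2 * e′ + L * L + 2 * (e′ * (L * L)))
    (ring R n (suc Q) e′ (L * L))
  where
  ring : ∀ R n Q e L → suc (2 * (R * n) + L) + (2 * (R * (Q * suc e)) + 2 * (suc e * suc e)) + (1 + 2 * e + L + 2 * (e * L))
    ≡ 2 * (suc e * suc e) + (2 * (R * n) + 2 * (suc e * (R * Q + L + 1)))
  ring = solve-∀
core-size R Q n zero L h₁ h₂ = ⊥-elim (<⇒≱ (m≤n+m 1 (R * suc Q + L * L)) h₂)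

Conclusion : ∀ {m} → Graph (Fin m) → ℕ → (ℕ → ℕ) → ℕ → Set
Conclusion F h exF n = IsEx n (copies h F) (term exF n h)
  × maxFrom1 h (term exF n) ≡ term exF n h
  × (∀ (G : Graph (Fin n)) → InEX n (copies h F) G → JoinStructure F G (h ∸ 1) ((n + 1) ∸ h))

module Main {m} (F : Graph (Fin (suc m))) (u : Fin (suc m)) (r : ℕ)
  (colorable : Colorable F (2 + r)) (not-colorable : ¬ Colorable F (suc r)) (colorable-u : Colorable (deleteVertex F u) (suc r))
  (h′ : ℕ) where

  h = suc h′

  turán-free : ∀ n → Free (copies h F) (turán (suc r) n)
  turán-free n copy = not-colorable (contains-colorable {F = F} {G = turán (suc r) n} (contains-trans {E = F} {F = copies h F} {G = turán (suc r) n} (copies-contain F h′) copy) (turán-colorable (suc r) n))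

  -- hF is (r + 2)-colourable with h |F| vertices, and `combine` gives each of them a position of
  -- its own.
  no-blowup : ∀ {n} (G : Graph (Fin n)) → Free (copies h F) G → ¬ Blowup G full (2 + r) (h * suc m)
  no-blowup G free K = free (embedding⇒contains (embed-colourable (copies h F) K (copies-colorable F h colorable)
    (λ (i , x) → combine i x) (λ { {i , x} {j , y} e → let (p , q) = combine-injective i x j y e in cong₂ _,_ p q })))

  -- The exchange needs n > Q e. The value of q₂ makes q₂ + 1 = (Q + 2)², so that n ≤ (Q + 2) e
  -- yields n² ≤ (q₂ + 1) e².
  Q q₂ : ℕ
  Q = thresholdFactor r (suc m)
  q₂ = suc Q + suc Q * suc (suc Q)

  CoreFinder : ℕ → Set
  CoreFinder L = ∀ {n} (G : Graph (Fin n)) k e → ¬ Blowup G full (2 + r) (h * suc m) →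
    nonEdges G full ≤ n * suc k → suc r * k ≤ n → n + e ≤ suc r * (k + e) →
    n * n ≤ suc q₂ * (e * e) → 2 * (suc r * n) + L * L < 2 * (e * e) →
    Σ (Sub n) λ S → n ≤ # S + e × Sparse G S (k + e)

  -- All error terms are measured in multiples of e = n / (Q + 1), which has to be at least this large.
  unit : ℕ → ℕ → ℕ → ℕ
  unit L L₁ L₂ = (suc r * suc (suc Q) + L * L + 1) + (L₁ + (L₂ + (suc r * (h * (h + 2 * (h * suc m))) + Q)))

  structure : ∀ L L₁ L₂ → CoreFinder L → BlowupFinder r m (suc Q) L₁ → BlowupFinder r (suc m + suc Q * (2 + m)) (suc Q) L₂ →
    ∀ n → suc Q * unit L L₁ L₂ ≤ n → ∀ G → InEX n (copies h F) G → JoinStructure F G h′ ((n + 1) ∸ h)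
  structure L L₁ L₂ find-core find₁ find₂ n n-large G extremal = from-core (find-core G k e (no-blowup G (proj₁ extremal)) nonEdges≤ Rk≤ n+e≤ n²≤ (core-size (suc r) (suc Q) n e L n≤ (≤-trans (m≤m+n _ _) unit≤)))
    where
    -- Then Q e < n ≤ (Q + 2) e: the remainder is at most Q, and `unit` forces e ≥ 1 and e ≥ Q.
    e = n / suc Q
    k = n / suc r
    c₃ = suc r * (h * (h + 2 * (h * suc m)))
    unit≤ : unit L L₁ L₂ ≤ e
    unit≤ = n/Q≥ Q (unit L L₁ L₂) n n-large
    tail₁ : L₁ + (L₂ + (c₃ + Q)) ≤ e
    tail₁ = ≤-trans (m≤n+m _ (suc r * suc (suc Q) + L * L + 1)) unit≤
    tail₂ : L₂ + (c₃ + Q) ≤ e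
    tail₂ = ≤-trans (m≤n+m _ L₁) tail₁
    tail₃ : c₃ + Q ≤ e
    tail₃ = ≤-trans (m≤n+m _ L₂) tail₂
    1≤e : 1 ≤ e
    1≤e = ≤-trans (≤-trans (m≤n+m 1 (suc r * suc (suc Q) + L * L)) (m≤m+n _ _)) unit≤
    n≤ : n ≤ suc (suc Q) * e
    n≤ = ≤-trans (n<[1+n/Q]*Q Q n) (≤-trans (+-monoʳ-≤ (suc Q * e) (≤-trans (m≤n+m Q c₃) tail₃)) (≤-reflexive (+-comm (suc Q * e) e)))
    n> : Q * e < n
    n> = ≤-trans (+-monoˡ-≤ (Q * e) 1≤e) (≤-trans (≤-reflexive (*-comm (suc Q) e)) (m/n*n≤m n (suc Q)))
    Rk≤ : suc r * k ≤ n
    Rk≤ = ≤-trans (≤-reflexive (*-comm (suc r) k)) (m/n*n≤m n (suc r))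
    n+e≤ : n + e ≤ suc r * (k + e)
    n+e≤ = linear (+-mono-≤ (n<[1+n/Q]*Q r n) (*-monoʳ-≤ r 1≤e)) 0 (ring n e r k)
      where
      ring : ∀ n e r k → n + e + (suc r * k + r + r * e) + 0 ≡ suc r * (k + e) + (n + r * 1)
      ring = solve-∀
    n²≤ : n * n ≤ suc q₂ * (e * e)
    n²≤ = ≤-trans (*-mono-≤ n≤ n≤) (≤-reflexive (ring (suc (suc Q)) e))
      where
      ring : ∀ a e → a * e * (a * e) ≡ a * a * (e * e)
      ring = solve-∀
    -- The Turán graph with r + 1 classes is hF-free, because F is not (r + 1)-colourable; so G has
    -- at most as many non-edges.
    nonEdges≤ : nonEdges G full ≤ n * suc k
    nonEdges≤ = ≤-trans (nonEdges-antitone (turán (suc r) n) G (proj₂ extremal (turán (suc r) n) (turán-free n))) (turán-nonEdges (suc r) n)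
    from-core : Σ (Sub n) (λ S → n ≤ # S + e × Sparse G S (k + e)) → JoinStructure F G h′ ((n + 1) ∸ h)
    from-core (S , large , sparse) = join-structure F h G extremal big
        (subst₂ (Splitting big) #big #rest (splitting big)) ≤-refl big-universal free-outside-big
      where
      open Structure F u r (proj₁ (colour-except F u colorable-u)) (proj₂ (colour-except F u colorable-u)) h (suc Q) L₁ L₂ find₁ find₂
        G extremal S e (k + e) large sparse
        (≤-trans (≤-reflexive (*-distribˡ-+ (suc r) k e)) (+-monoˡ-≤ (suc r * e) Rk≤)) n≤ n>
        (≤-trans (m≤m+n L₁ _) tail₁) (≤-trans (m≤m+n L₂ _) tail₂) (≤-trans (m≤m+n c₃ Q) tail₃)
      #rest : # (not ∘ big) ≡ (n + 1) ∸ h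
      #rest = begin
        # (not ∘ big)                       ≡⟨ m+n∸m≡n (# big) _ ⟨
        # big + # (not ∘ big) ∸ # big       ≡⟨ cong₂ _∸_ (#-compl big) #big ⟩
        n ∸ h′                              ≡⟨ cong (_∸ h) (+-comm n 1) ⟨
        (n + 1) ∸ h                         ∎
        where open ≡-Reasoning

  -- The extremal graph is exhibited as a join. Its maximality is indirect: `structured` gives all
  -- extremal graphs the same number of edges, and `extremal-bound` extends this bound to all
  -- hF-free graphs.
  conclude : ∀ exF → (∀ n → IsEx n F (exF n)) → ∀ n → h ≤ n →
    (∀ (G : Graph (Fin n)) → InEX n (copies h F) G → JoinStructure F G h′ ((n + 1) ∸ h)) → Conclusion F h exF n
  conclude exF isEx n h≤n structured = (G , (G-free , G-max) , G-size) ,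
      maxFrom1-last h′ (term exF n) (λ ℓ ℓ<h′ → term-step F exF isEx n ℓ (≤-trans ℓ<h′ (≤-trans (n≤1+n h′) h≤n))) , structured
    where
    b = (n + 1) ∸ h
    H = proj₁ (isEx b)
    B = subset-of-size h′ (full {n}) (subst (h′ ≤_) (sym (#-full n)) (≤-trans (n≤1+n h′) h≤n))
    #rest : # (not ∘ proj₁ B) ≡ b
    #rest = begin
      # (not ∘ proj₁ B)                                ≡⟨ m+n∸m≡n (# (proj₁ B)) _ ⟨
      # (proj₁ B) + # (not ∘ proj₁ B) ∸ # (proj₁ B)    ≡⟨ cong₂ _∸_ (#-compl (proj₁ B)) (proj₂ (proj₂ B)) ⟩
      n ∸ h′                                           ≡⟨ cong (_∸ h) (+-comm n 1) ⟨
      b                                                ∎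
      where open ≡-Reasoning
    σ : Splitting (proj₁ B) h′ b
    σ = subst₂ (Splitting (proj₁ B)) (proj₂ (proj₂ B)) #rest (splitting (proj₁ B))
    G : Graph (Fin n)
    G = joinK (bij σ) H
    G-free : Free (copies h F) G
    G-free = joinK-free F h (bij σ) H ≤-refl (proj₁ (proj₁ (proj₂ (isEx b))))
    G-size : edgeCount G ≡ term exF n h
    G-size = trans (edgeCount-joinK (bij σ) H) (cong (h′ choose 2 + h′ * b +_) (proj₂ (proj₂ (isEx b))))
    G-max : ∀ G′ → Free (copies h F) G′ → edgeCount G′ ≤ edgeCount G
    G-max G′ free′ = ≤-trans (extremal-bound (copies h F) n (term exF n h)
      (λ G″ ex → structure-edges F G″ (exF b) (isEx b) (structured G″ ex)) G′ free′) (≤-reflexive (sym G-size))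

  theorem : ∀ exF → (∀ n → IsEx n F (exF n)) → Σ ℕ λ N → ∀ n → N ≤ n → Conclusion F h exF n
  theorem exF isEx = suc Q * unit L L₁ L₂ + h , λ n N≤n → conclude exF isEx n (≤-trans (m≤n+m h (suc Q * unit L L₁ L₂)) N≤n)
      (structure L L₁ L₂ (proj₂ core) (proj₂ es₁) (proj₂ es₂) n (≤-trans (m≤m+n (suc Q * unit L L₁ L₂) h) N≤n))
    where
    core : Σ ℕ CoreFinder
    -- The parts have one vertex more than the second argument, that is, h |F| vertices.
    core = sparse-core r (m + h′ * suc m) q₂
    es₁ : Σ ℕ (BlowupFinder r m (suc Q))
    es₁ = erdős-stone r m (suc Q)
    es₂ : Σ ℕ (BlowupFinder r (suc m + suc Q * (2 + m)) (suc Q))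
    es₂ = erdős-stone r (suc m + suc Q * (2 + m)) (suc Q)
    L = proj₁ core
    L₁ = proj₁ es₁
    L₂ = proj₁ es₂

theorem4 : ∀ {m : ℕ} (F : Graph (Fin (suc m))) →
    VertexCritical F →
    Σ ℕ (λ k → HasChromaticNumber F k × 3 ≤ k) →
    ∀ (h : ℕ) → 2 ≤ h →
    ∀ (exF : ℕ → ℕ) → (∀ n → IsEx n F (exF n)) →
    Σ ℕ λ N → ∀ n → N ≤ n →
    IsEx n (copies h F) (term exF n h)
    × maxFrom1 h (term exF n) ≡ term exF n h
    × (∀ (G : Graph (Fin n)) → InEX n (copies h F) G →
    Σ (Graph (Fin ((n + 1) ∸ h))) λ H →
    InEX ((n + 1) ∸ h) F H
    × Isomorphic G (join (complete (h ∸ 1)) H))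
theorem4 F (u , k , (col , minimal) , (col-u , _)) (k₀ , (_ , minimal₀) , 3≤k₀) (suc h′) _ exF isEx =
  -- Minimality of k₀, applied to a colouring with the k colours from vertex-criticality, carries
  -- the bound 3 over to k.
  at-least-3 k (≤-trans 3≤k₀ (minimal₀ k col)) col minimal col-u
  where
  at-least-3 : ∀ k → 3 ≤ k → Colorable F k → (∀ j → Colorable F j → k ≤ j) → Colorable (deleteVertex F u) (k ∸ 1) →
    Σ ℕ λ N → ∀ n → N ≤ n → Conclusion F (suc h′) exF n
  at-least-3 (suc zero) (s≤s ())
  at-least-3 (suc (suc r)) _ col minimal col-u =
    Main.theorem F u r col (λ c → <-irrefl refl (minimal (suc r) c)) col-u h′ exF isEx
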